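{- Let $\sigma_1,\dots,\sigma_k$ be non-crossing partitions and let $p$ be a permutation of $\{1,\dots,k\}$. Then $\sigma_1[\sigma_2]\cdots[\sigma_k]$ and $\sigma_{p(1)}[\sigma_{p(2)}]\cdots[\sigma_{p(k)}]$ are cc-equivalent.
   Context: Set partitions are written in canonical sequential form (restricted growth words). A partition is non-crossing if it avoids the pattern $1212$ (pattern containment = having a subsequence order-isomorphic to the pattern). For partitions $\alpha,\beta$, $\alpha[\beta]$ is the concatenation of $\alpha$ with $\beta+r$, $r$ the number of blocks of $\alpha$ (adding $r$ to every letter of $\beta$); this operation is associative. A partition is connected if it cannot be written as $\alpha[\beta]$ with $\alpha,\beta$ nonempty; the components of $\pi$ are the unique nonempty connected $\sigma_i$ with $\pi=\sigma_1[\sigma_2]\cdots[\sigma_m]$. Two non-crossing patterns $\sigma,\tau$ are cc-equivalent if there is a bijection from the set of partitions avoiding both $1212$ and $\sigma$ to the set of partitions avoiding both $1212$ and $\tau$ that preserves size and number of components. -}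

module Defs where

open import Data.Fin.Base using (cast)
open import Data.List.Base using (List; []; _∷_; _++_; map; foldr; length; lookup)
open import Data.List.Relation.Binary.Sublist.Propositional using (_⊆_)
open import Data.List.Relation.Unary.All using (All)
open import Data.List.Membership.Propositional using (_∈_)
open import Data.List.Relation.Unary.Any using (here; there)
open import Data.Nat.Base using (ℕ; suc; _+_; _⊔_; _≤_; _<_; z≤n; s≤s)
open import Data.Nat.Properties
open import Data.Product.Base using (Σ-syntax; ∃-syntax; _×_; _,_; proj₁; proj₂)
open import Data.Refinement using (Refinement; value; _,_)
open import Data.Irrelevant using () renaming ([_] to irr)
open import Function.Bundles using (_⇔_; _⤖_; mk⇔; module Bijection)
open import Relation.Binary.PropositionalEquality using (_≡_; _≢_; refl; sym; subst)
open import Relation.Nullary using (¬_; yes; no; contradiction)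

-- `RGWFrom m w`: w may follow a word whose largest letter is m (0 if that word
-- is empty) in a restricted growth word.  Letters are positive.
data RGWFrom (m : ℕ) : List ℕ → Set where
  []   : RGWFrom m []
  cons : ∀ {x xs} → 1 ≤ x → x ≤ suc m → RGWFrom (m ⊔ x) xs → RGWFrom m (x ∷ xs)

-- Set partitions in canonical sequential form.  The proof component is
-- irrelevant, so propositional equality of partitions is equality of words.
Partition : Set
Partition = Refinement (List ℕ) (RGWFrom 0)

word : Partition → List ℕ
word = value

size : Partition → ℕ
size π = length (word π)

-- The letters of a restricted growth word are exactly 1, …, r where r is the
-- number of blocks (see `letters`), so r is the largest letter.
maxLetter : List ℕ → ℕ
maxLetter = foldr _⊔_ 0

blocks : Partition → ℕ
blocks π = maxLetter (word π)

letter-≥1 : ∀ {m w x} → RGWFrom m w → x ∈ w → 1 ≤ x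
letter-≥1 (cons 1≤y _ _) (here refl) = 1≤y
letter-≥1 (cons _ _ p)   (there x∈w) = letter-≥1 p x∈w

letter-≤max : ∀ {w x} → x ∈ w → x ≤ maxLetter w
letter-≤max {y ∷ w} (here refl) = m≤m⊔n y (maxLetter w)
letter-≤max {y ∷ w} (there x∈w) = ≤-trans (letter-≤max x∈w) (m≤n⊔m y (maxLetter w))

letter-∈ : ∀ {m w x} → RGWFrom m w → m < x → x ≤ m ⊔ maxLetter w → x ∈ w
letter-∈ {m} [] m<x x≤m =
  contradiction (subst (_ ≤_) (⊔-identityʳ m) x≤m) (<⇒≱ m<x)
letter-∈ {m} {y ∷ w} {x} (cons _ y≤1+m p) m<x x≤max with x ≟ y
... | yes refl = here refl
... | no  x≢y  = there (letter-∈ p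
  (⊔-lub m<x (≤∧≢⇒< (≤-trans y≤1+m m<x) (λ y≡x → x≢y (sym y≡x))))
  (subst (x ≤_) (sym (⊔-assoc m y (maxLetter w))) x≤max))

letters : ∀ {w} → RGWFrom 0 w → ∀ x → x ∈ w ⇔ (1 ≤ x × x ≤ maxLetter w)
letters p x = mk⇔ (λ x∈w → letter-≥1 p x∈w , letter-≤max x∈w)
                  (λ x∈[1,r] → letter-∈ p (proj₁ x∈[1,r]) (proj₂ x∈[1,r]))

RGWFrom-shift : ∀ r m {w} → RGWFrom m w → RGWFrom (r + m) (map (r +_) w)
RGWFrom-shift r m []                         = []
RGWFrom-shift r m (cons {x} {xs} 1≤x x≤1+m p) = cons
  (≤-trans 1≤x (m≤n+m x r))
  (≤-trans (+-monoʳ-≤ r x≤1+m) (≤-reflexive (+-suc r m)))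
  (subst (λ k → RGWFrom k (map (r +_) xs)) (+-distribˡ-⊔ r m x) (RGWFrom-shift r (m ⊔ x) p))

RGWFrom-++ : ∀ m {u v} → RGWFrom m u → RGWFrom (m ⊔ maxLetter u) v → RGWFrom m (u ++ v)
RGWFrom-++ m {v = v} [] q = subst (λ k → RGWFrom k v) (⊔-identityʳ m) q
RGWFrom-++ m {v = v} (cons {x} {xs} a b p) q = cons a b
  (RGWFrom-++ (m ⊔ x) p (subst (λ k → RGWFrom k v) (sym (⊔-assoc m x (maxLetter xs))) q))

RGWFrom-concat : ∀ u {v} → RGWFrom 0 u → RGWFrom 0 v →
                 RGWFrom 0 (u ++ map (maxLetter u +_) v)
RGWFrom-concat u {v} p q = RGWFrom-++ 0 p
  (subst (λ k → RGWFrom k (map (maxLetter u +_) v)) (+-identityʳ (maxLetter u))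
    (RGWFrom-shift (maxLetter u) 0 q))

infixl 6 _[_]

_[_] : Partition → Partition → Partition
α@(u , irr p) [ (v , irr q) ] = (u ++ map (blocks α +_) v) , irr (RGWFrom-concat u p q)

∅ : Partition
∅ = [] , irr []

-- σ₁[σ₂]⋯[σₖ], bracketed to the right; ∅ is a two-sided unit for _[_].
bracket : List Partition → Partition
bracket = foldr _[_] ∅

-- As i, j range over all pairs of positions, this matches equal letters too.
OrderIsomorphic : List ℕ → List ℕ → Set
OrderIsomorphic u v = Σ[ eq ∈ length u ≡ length v ]
  (∀ i j → (lookup u i < lookup u j) ⇔ (lookup v (cast eq i) < lookup v (cast eq j)))

Contains : Partition → Partition → Set
Contains π σ = ∃[ w ] (w ⊆ word π × OrderIsomorphic w (word σ))

Avoids : Partition → Partition → Set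
Avoids π σ = ¬ Contains π σ

1212-pattern : Partition
1212-pattern = (1 ∷ 2 ∷ 1 ∷ 2 ∷ []) , irr (
  cons (s≤s z≤n) (s≤s z≤n)
    (cons (s≤s z≤n) (s≤s (s≤s z≤n))
      (cons (s≤s z≤n) (s≤s z≤n)
        (cons (s≤s z≤n) (s≤s (s≤s z≤n)) []))))

NonCrossing : Partition → Set
NonCrossing π = Avoids π 1212-pattern

NonEmpty : Partition → Set
NonEmpty π = π ≢ ∅

Connected : Partition → Set
Connected π = ¬ (∃[ α ] ∃[ β ] (NonEmpty α × NonEmpty β × π ≡ α [ β ]))

Components : Partition → List Partition → Set
Components π σs = All NonEmpty σs × All Connected σs × π ≡ bracket σs

-- The components of π are unique, so this holds for exactly one m.
NumberOfComponents : Partition → ℕ → Set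
NumberOfComponents π m = ∃[ σs ] (Components π σs × length σs ≡ m)

Avoiders : Partition → Set
Avoiders σ = Refinement Partition (λ π → NonCrossing π × Avoids π σ)

record CCEquivalent (σ τ : Partition) : Set where
  field
    nonCrossingˡ : NonCrossing σ
    nonCrossingʳ : NonCrossing τ
    bijection    : Avoiders σ ⤖ Avoiders τ

  open Bijection bijection using (to)

  field
    preservesSize       : ∀ π → size (value (to π)) ≡ size (value π)
    preservesComponents : ∀ π m → NumberOfComponents (value π) m ⇔
                                  NumberOfComponents (value (to π)) m

{-# OPTIONS --safe #-}

-- Reading a non-crossing word from the left, the letters that may still be
-- repeated are those with no smaller letter after them.  Their number is the
-- number of components of the prefix, and repeating one of them closes all
-- larger ones.  Hence non-crossing partitions are paths of levels, each step
-- going from level h to some level in 1, …, h + 1, and the final level is the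
-- number of components.
--
-- Let u be the shortest prefix of π that contains α.  The letters after u are
-- either repetitions of open letters of u, whose levels weakly decrease, or new
-- letters, which form a non-crossing partition W cut between components by the
-- repetitions; and π contains α[β] iff W contains β.  So π is given by u, W and
-- a chain of pairs (level in u, cut position in W), decreasing in both entries.
-- If a is the number of components of u and b is one more than that of W, the
-- number of chains is symmetric in a and b.  The product of formal sums of
-- levels that it defines is also associative, so the operators "put a prefix
-- containing α in front" commute for different α, and the number of partitions
-- with given size and number of components that contain σ₁[σ₂]⋯[σₖ] does not
-- depend on the order of the σᵢ.  Neither does, by subtraction, the number of
-- those that avoid it.
module Submission where

open import Defs
open import Data.Nat.Base using (ℕ)
open import Data.Fin.Base using (Fin)
open import Data.Fin.Permutation using (Permutation′; _⟨$⟩ʳ_)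
open import Data.List.Base using (tabulate)

import Algebra.Properties.CommutativeMonoid.Sum as CommutativeMonoidSum
open import Data.Bool.Base using (Bool; true; false; if_then_else_)
open import Data.Empty using (⊥-elim-irr)
open import Data.Fin.Base using (zero; suc; cast)
open import Data.Fin.Properties using (all?; cast-trans; cast-involutive)
open import Data.Irrelevant using () renaming ([_] to irr)
open import Data.List.Base
  using (List; []; _∷_; _++_; _∷ʳ_; map; length; lookup; filter; zip; take; drop; concatMap; applyUpTo)
open import Data.List.Membership.Propositional using (_∈_; find; lose)
open import Data.List.Membership.Propositional.Properties
  using (∈-++⁺ˡ; ∈-++⁺ʳ; ∈-++⁻; ∈-map⁺; ∈-map⁻; ∈-∃++; ∈-filter⁺; ∈-filter⁻;
         ∈-concatMap⁺; ∈-concatMap⁻; ∈-applyUpTo⁺; ∈-applyUpTo⁻)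
open import Data.List.Properties
  using (map-id; map-∘; map-cong; map-injective; map-++; length-map; length-++; length-take;
         ++-assoc; ++-identityʳ; ++-conicalˡ; ++-cancelˡ; ∷-injective; ∷-injectiveˡ; ∷-injectiveʳ;
         ∷ʳ-injective; ∷ʳ-injectiveʳ; filter-all; filter-accept; filter-reject; filter-++;
         take++drop≡id; take-all)
open import Data.List.Relation.Binary.Permutation.Propositional
  using (_↭_; ↭-trans; ↭-reflexive)
import Data.List.Relation.Binary.Permutation.Propositional as Perm
open import Data.List.Relation.Binary.Permutation.Propositional.Properties using (++-commutativeMonoid)
open import Data.List.Relation.Binary.Sublist.Propositional
  using (_⊆_; []; _∷_; ⊆-refl; ⊆-trans; minimum; from∈; to∈) renaming (_∷ʳ_ to _∷ˢ_; lookup to ∈-⊆)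
open import Data.List.Relation.Binary.Sublist.Propositional.Properties
  using (++⁺; ++⁺ˡ; ++⁺ʳ; map⁺; filter⁺; filter-⊆; ∷ˡ⁻)
open import Data.List.Relation.Unary.All as All using (All; []; _∷_)
import Data.List.Relation.Unary.All.Properties as All
open import Data.List.Relation.Unary.AllPairs as AllPairs using ([]; _∷_)
import Data.List.Relation.Unary.AllPairs.Properties as AllPairs
open import Data.List.Relation.Unary.Any using (here; there)
open import Data.List.Relation.Unary.Unique.Propositional using (Unique)
import Data.List.Relation.Unary.Unique.Propositional.Properties as Unique
open import Data.List.Reverse using (reverseView; Reverse; []; _∶_∶ʳ_)
open import Data.Nat.Base
  using (zero; suc; pred; _+_; _⊔_; _≤_; _<_; z≤n; s≤s; s≤s⁻¹; z<s; s<s)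
open import Data.Nat.ListAction using (sum)
open import Data.Nat.ListAction.Properties using (sum-++)
open import Data.Nat.Properties
open import Algebra.Properties.CommutativeSemigroup +-commutativeSemigroup using (interchange; x∙yz≈y∙xz)
open import Data.Product.Base using (∃-syntax; _×_; _,_; proj₁; proj₂)
open import Data.Refinement using (value; value-injective; _,_)
open import Data.Sum.Base using (_⊎_; inj₁; inj₂)
open import Data.Unit.Base using (⊤; tt)
open import Function.Base using (_∘_)
open import Function.Bundles using (_⇔_; mk⇔; mk⤖; module Equivalence)
open import Relation.Binary.Definitions using (tri<; tri≈; tri>)
open import Relation.Binary.PropositionalEquality hiding ([_])
open import Relation.Nullary using (¬_; Dec; yes; no; does; contradiction; ¬?; recompute)
open import Relation.Nullary.Decidable
  using (map′; _×-dec_; _→-dec_; _⊎-dec_; does-⇔; dec-true)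

open Equivalence using (to; from)

-- Finite sums

Σ< : ℕ → (ℕ → ℕ) → ℕ
Σ< zero    f = 0
Σ< (suc n) f = f 0 + Σ< n (λ i → f (suc i))

Σ<-cong : ∀ n {f g} → (∀ i → f i ≡ g i) → Σ< n f ≡ Σ< n g
Σ<-cong zero    h = refl
Σ<-cong (suc n) h = cong₂ _+_ (h 0) (Σ<-cong n (λ i → h (suc i)))

Σ<-cong-< : ∀ n {f g} → (∀ i → i < n → f i ≡ g i) → Σ< n f ≡ Σ< n g
Σ<-cong-< zero    h = refl
Σ<-cong-< (suc n) h = cong₂ _+_ (h 0 z<s) (Σ<-cong-< n (λ i i<n → h (suc i) (s<s i<n)))

Σ<-0 : ∀ n → Σ< n (λ _ → 0) ≡ 0
Σ<-0 zero    = refl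
Σ<-0 (suc n) = Σ<-0 n

Σ<-+ : ∀ n f g → Σ< n (λ i → f i + g i) ≡ Σ< n f + Σ< n g
Σ<-+ zero    f g = refl
Σ<-+ (suc n) f g = trans (cong (f 0 + g 0 +_) (Σ<-+ n _ _)) (interchange (f 0) (g 0) _ _)

Σ<-swap : ∀ m n (f : ℕ → ℕ → ℕ) → Σ< m (λ i → Σ< n (f i)) ≡ Σ< n (λ j → Σ< m (λ i → f i j))
Σ<-swap zero    n f = sym (Σ<-0 n)
Σ<-swap (suc m) n f =
  trans (cong (Σ< n (f 0) +_) (Σ<-swap m n (λ i → f (suc i)))) (sym (Σ<-+ n (f 0) _))

Σ<-split : ∀ m n f → Σ< (m + n) f ≡ Σ< m f + Σ< n (λ i → f (m + i))
Σ<-split zero    n f = refl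
Σ<-split (suc m) n f = trans (cong (f 0 +_) (Σ<-split m n _)) (sym (+-assoc (f 0) _ _))

Σ<-last : ∀ n f → Σ< (suc n) f ≡ Σ< n f + f n
Σ<-last zero    f = +-identityʳ (f 0)
Σ<-last (suc n) f = trans (cong (f 0 +_) (Σ<-last n _)) (sym (+-assoc (f 0) _ _))

-- The sum of f l k over l + suc k ≡ b.
Σ≡ : ℕ → (ℕ → ℕ → ℕ) → ℕ
Σ≡ zero    f = 0
Σ≡ (suc b) f = f 0 b + Σ≡ b (λ l → f (suc l))

Σ≡-cong : ∀ b {f g} → (∀ l k → l + suc k ≡ b → f l k ≡ g l k) → Σ≡ b f ≡ Σ≡ b g
Σ≡-cong zero    h = refl
Σ≡-cong (suc b) h = cong₂ _+_ (h 0 b refl) (Σ≡-cong b (λ l k e → h (suc l) k (cong suc e)))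

Σ≡-+ : ∀ b f g → Σ≡ b (λ l k → f l k + g l k) ≡ Σ≡ b f + Σ≡ b g
Σ≡-+ zero    f g = refl
Σ≡-+ (suc b) f g = trans (cong (f 0 b + g 0 b +_) (Σ≡-+ b _ _)) (interchange (f 0 b) (g 0 b) _ _)

Σ≡-0 : ∀ b → Σ≡ b (λ _ _ → 0) ≡ 0
Σ≡-0 zero    = refl
Σ≡-0 (suc b) = Σ≡-0 b

Σ≡-last : ∀ b f → Σ≡ (suc b) f ≡ f b 0 + Σ≡ b (λ l k → f l (suc k))
Σ≡-last zero    f = refl
Σ≡-last (suc b) f =
  trans (cong (f 0 (suc b) +_) (Σ≡-last b (λ l → f (suc l)))) (x∙yz≈y∙xz (f 0 (suc b)) (f (suc b) 0) _)

Σ≡-reverse : ∀ b f → Σ≡ b (λ _ k → f k) ≡ Σ< b f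
Σ≡-reverse zero    f = refl
Σ≡-reverse (suc b) f =
  trans (cong (f b +_) (Σ≡-reverse b f)) (trans (+-comm (f b) _) (sym (Σ<-last b f)))

-- Both sides range over the triangle `l + x < b`; the right side groups its points by `y = l + x`.
Σ≡-triangle : ∀ b (f : ℕ → ℕ → ℕ → ℕ) →
  Σ≡ b (λ l k → Σ< (suc k) (λ x → f l x (l + x))) ≡
  Σ< b (λ y → Σ≡ (suc y) (λ l x → f l x y))
Σ≡-triangle zero    f = refl
Σ≡-triangle (suc b) f = begin
  Σ< (suc b) (λ x → f 0 x x) + Σ≡ b (λ l k → Σ< (suc k) (λ x → f (suc l) x (suc l + x)))
    ≡⟨ cong (Σ< (suc b) (λ x → f 0 x x) +_) (Σ≡-triangle b (λ l x y → f (suc l) x (suc y))) ⟩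
  Σ< (suc b) (λ x → f 0 x x) + Σ< (suc b) (λ y → Σ≡ y (λ l x → f (suc l) x y))
    ≡⟨ Σ<-+ (suc b) (λ x → f 0 x x) (λ y → Σ≡ y (λ l x → f (suc l) x y)) ⟨
  Σ< (suc b) (λ y → Σ≡ (suc y) (λ l x → f l x y)) ∎
  where open ≡-Reasoning

-- The cost of one step. For generating functions in the budget this is multiplication by the
-- variable.
delay : (ℕ → ℕ) → ℕ → ℕ
delay f zero    = 0
delay f (suc n) = f n

delay-cong : ∀ {f g} → (∀ n → f n ≡ g n) → ∀ n → delay f n ≡ delay g n
delay-cong h zero    = refl
delay-cong h (suc n) = h n

-- Chains of repetitions and cuts

-- Sums over the chains (a , b) → (a₁ , b₁) → ⋯ with a ≥ a₁ ≥ ⋯ ≥ 1 and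
-- b ≥ b₁ ≥ ⋯ ≥ 1 of the weight of the last pair.  Each step uses one unit of
-- the budget n, and q counts by how much b has dropped.
chains : (ℕ → ℕ → ℕ → ℕ → ℕ) → (n a q b : ℕ) → ℕ
chains ψ zero    a q b = ψ zero a q b
chains ψ (suc n) a q b = ψ (suc n) a q b +
  Σ< a (λ j → Σ≡ b (λ l k → chains ψ n (suc j) (q + l) (suc k)))

chains-cong : ∀ {ψ χ} n → (∀ n′ a q b → n′ ≤ n → ψ n′ a q b ≡ χ n′ a q b) →
              ∀ a q b → chains ψ n a q b ≡ chains χ n a q b
chains-cong zero    h a q b = h 0 a q b z≤n
chains-cong (suc n) h a q b = cong₂ _+_ (h (suc n) a q b ≤-refl)
  (Σ<-cong a λ j → Σ≡-cong b λ l k _ →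
    chains-cong n (λ n′ a′ q′ b′ n′≤n → h n′ a′ q′ b′ (m≤n⇒m≤1+n n′≤n)) (suc j) (q + l) (suc k))

chains-0 : ∀ n a q b → chains (λ _ _ _ _ → 0) n a q b ≡ 0
chains-0 zero    a q b = refl
chains-0 (suc n) a q b =
  trans (Σ<-cong a λ j → trans (Σ≡-cong b λ l k _ → chains-0 n (suc j) (q + l) (suc k)) (Σ≡-0 b)) (Σ<-0 a)

chains-+ : ∀ ψ χ n a q b → chains (λ n a q b → ψ n a q b + χ n a q b) n a q b ≡
           chains ψ n a q b + chains χ n a q b
chains-+ ψ χ zero    a q b = refl
chains-+ ψ χ (suc n) a q b = begin
  ψ (suc n) a q b + χ (suc n) a q b + Σ< a (λ j → Σ≡ b λ l k → chains (λ n a q b → ψ n a q b + χ n a q b) n (suc j) (q + l) (suc k))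
    ≡⟨ cong (ψ (suc n) a q b + χ (suc n) a q b +_)
         (trans (Σ<-cong a λ j → trans (Σ≡-cong b λ l k _ → chains-+ ψ χ n (suc j) (q + l) (suc k)) (Σ≡-+ b _ _))
                (Σ<-+ a _ _)) ⟩
  _ ≡⟨ interchange (ψ (suc n) a q b) (χ (suc n) a q b) _ _ ⟩
  _ ∎
  where open ≡-Reasoning

chains-b0 : ∀ ψ n a q → chains ψ n a q 0 ≡ ψ n a q 0
chains-b0 ψ zero    a q = refl
chains-b0 ψ (suc n) a q = trans (cong (ψ (suc n) a q 0 +_) (Σ<-0 a)) (+-identityʳ _)

-- Every step costs one unit, so a unit paid at the end of a chain can be taken off the budget
-- before it starts.
chains-delay : ∀ (f : ℕ → ℕ → ℕ → ℕ → ℕ) n a q b →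
  chains (λ n a q b → delay (λ n′ → f n′ a q b) n) n a q b ≡
  delay (λ n′ → chains f n′ a q b) n
chains-delay f zero          a q b = refl
chains-delay f (suc zero)    a q b =
  trans (cong (f 0 a q b +_) (trans (Σ<-cong a λ j → Σ≡-0 b) (Σ<-0 a))) (+-identityʳ _)
chains-delay f (suc (suc n)) a q b =
  cong (f (suc n) a q b +_) (Σ<-cong a λ j → Σ≡-cong b λ l k _ → chains-delay f (suc n) (suc j) (q + l) (suc k))

-- A chain ending with b = 1 is trivial or is a chain followed by a step to b = 1;
-- the other chains are shifted by one.
chains-last : ∀ ψ n a q b t → t ≡ q + b →
  chains ψ n a q (suc b) ≡
  chains (λ n a q b → ψ n a q (suc b)) n a q b +
  chains (λ n a q b → delay (λ n′ → Σ< a (λ j → ψ n′ (suc j) t 1)) n) n a q (suc b)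
chains-last ψ zero    a q b t e = sym (+-identityʳ _)
chains-last ψ (suc n) a q b t e = begin
  ψ (suc n) a q (suc b) + Σ< a (λ j → Σ≡ (suc b) λ l k → chains ψ n (suc j) (q + l) (suc k))
    ≡⟨ cong (ψ (suc n) a q (suc b) +_) (trans (Σ<-cong a inner) (trans (Σ<-+ a _ _) (cong (_+ Z) (Σ<-+ a _ _)))) ⟩
  ψ (suc n) a q (suc b) + (A + B + Z)
    ≡⟨ lemma (ψ (suc n) a q (suc b)) A B Z ⟩
  (ψ (suc n) a q (suc b) + B) + (A + Z) ∎
  where
  open ≡-Reasoning
  ψ′ ψ″ : ℕ → ℕ → ℕ → ℕ → ℕ
  ψ′ n a q b = ψ n a q (suc b)
  ψ″ n a q b = delay (λ n′ → Σ< a (λ j → ψ n′ (suc j) t 1)) n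
  A B Z : ℕ
  A = Σ< a (λ j → ψ n (suc j) t 1)
  B = Σ< a (λ j → Σ≡ b λ l k → chains ψ′ n (suc j) (q + l) (suc k))
  Z = Σ< a (λ j → Σ≡ (suc b) λ l k → chains ψ″ n (suc j) (q + l) (suc k))
  lemma : ∀ p x y z → p + (x + y + z) ≡ (p + y) + (x + z)
  lemma p x y z = begin
    p + (x + y + z) ≡⟨ cong (λ w → p + (w + z)) (+-comm x y) ⟩
    p + (y + x + z) ≡⟨ cong (p +_) (+-assoc y x z) ⟩
    p + (y + (x + z)) ≡⟨ +-assoc p y (x + z) ⟨
    (p + y) + (x + z) ∎
  -- `q` grows by exactly what `b` drops, so every step down to `b = 1` arrives at the same `q`,
  -- namely `t`.
  t≡ : ∀ l k → l + suc k ≡ suc b → t ≡ (q + l) + k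
  t≡ l k e′ = trans e (trans (cong (q +_) (suc-injective (sym (trans (sym (+-suc l k)) e′)))) (sym (+-assoc q l k)))
  inner : ∀ j → Σ≡ (suc b) (λ l k → chains ψ n (suc j) (q + l) (suc k)) ≡
    ψ n (suc j) t 1 + Σ≡ b (λ l k → chains ψ′ n (suc j) (q + l) (suc k)) +
    Σ≡ (suc b) (λ l k → chains ψ″ n (suc j) (q + l) (suc k))
  inner j = begin
    Σ≡ (suc b) (λ l k → chains ψ n (suc j) (q + l) (suc k))
      ≡⟨ Σ≡-cong (suc b) (λ l k e′ → chains-last ψ n (suc j) (q + l) k t (t≡ l k e′)) ⟩
    Σ≡ (suc b) (λ l k → chains ψ′ n (suc j) (q + l) k + chains ψ″ n (suc j) (q + l) (suc k))
      ≡⟨ Σ≡-+ (suc b) (λ l k → chains ψ′ n (suc j) (q + l) k) (λ l k → chains ψ″ n (suc j) (q + l) (suc k)) ⟩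
    Σ≡ (suc b) (λ l k → chains ψ′ n (suc j) (q + l) k) + Y
      ≡⟨ cong (_+ Y) (Σ≡-last b (λ l k → chains ψ′ n (suc j) (q + l) k)) ⟩
    chains ψ′ n (suc j) (q + b) 0 + X + Y
      ≡⟨ cong (λ z → z + X + Y) (trans (chains-b0 ψ′ n (suc j) (q + b)) (cong (λ z → ψ n (suc j) z 1) (sym e))) ⟩
    ψ n (suc j) t 1 + X + Y ∎
    where
    X Y : ℕ
    X = Σ≡ b (λ l k → chains ψ′ n (suc j) (q + l) (suc k))
    Y = Σ≡ (suc b) (λ l k → chains ψ″ n (suc j) (q + l) (suc k))

-- The position `q + r` chosen at the end of a chain can be fixed beforehand. Since `q` grows by
-- what `b` drops, the same drops started from `suc x` end at `suc r`.
chains-diagonal : ∀ (g : ℕ → ℕ → ℕ → ℕ → ℕ → ℕ) n a q b →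
  chains (λ n i q k → Σ< k (λ r → g (q + r) n i q (suc r))) n a q b ≡
  Σ< b (λ x → chains (g (q + x)) n a q (suc x))
chains-diagonal g zero    a q b = refl
chains-diagonal g (suc n) a q b = begin
  G + Σ< a (λ j → Σ≡ b λ l k → chains (λ n i q k → Σ< k (λ r → g (q + r) n i q (suc r))) n (suc j) (q + l) (suc k))
    ≡⟨ cong (G +_) (Σ<-cong a inner) ⟩
  G + Σ< a (λ j → Σ< b λ y → Σ≡ (suc y) λ l x → chains (g (q + y)) n (suc j) (q + l) (suc x))
    ≡⟨ cong (G +_) (Σ<-swap a b (λ j y → Σ≡ (suc y) λ l x → chains (g (q + y)) n (suc j) (q + l) (suc x))) ⟩
  G + Σ< b (λ y → Σ< a λ j → Σ≡ (suc y) λ l x → chains (g (q + y)) n (suc j) (q + l) (suc x))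
    ≡⟨ Σ<-+ b _ _ ⟨
  Σ< b (λ x → chains (g (q + x)) (suc n) a q (suc x)) ∎
  where
  open ≡-Reasoning
  G : ℕ
  G = Σ< b (λ r → g (q + r) (suc n) a q (suc r))
  inner : ∀ j →
    Σ≡ b (λ l k → chains (λ n i q k → Σ< k (λ r → g (q + r) n i q (suc r))) n (suc j) (q + l) (suc k)) ≡
    Σ< b (λ y → Σ≡ (suc y) λ l x → chains (g (q + y)) n (suc j) (q + l) (suc x))
  inner j = begin
    Σ≡ b (λ l k → chains (λ n i q k → Σ< k (λ r → g (q + r) n i q (suc r))) n (suc j) (q + l) (suc k))
      ≡⟨ Σ≡-cong b (λ l k _ → trans (chains-diagonal g n (suc j) (q + l) (suc k))
           (Σ<-cong (suc k) λ x → cong (λ z → chains (g z) n (suc j) (q + l) (suc x)) (+-assoc q l x))) ⟩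
    Σ≡ b (λ l k → Σ< (suc k) λ x → chains (g (q + (l + x))) n (suc j) (q + l) (suc x))
      ≡⟨ Σ≡-triangle b (λ l x y → chains (g (q + y)) n (suc j) (q + l) (suc x)) ⟩
    _ ∎

-- The product of two levels as a formal sum of levels, evaluated under the functional `φ`: the
-- chains of pairs with the position `q` forgotten, which makes the symmetry in `a` and `b` visible.
merge : (ℕ → ℕ → ℕ) → (n a b : ℕ) → ℕ
merge φ zero    a b = φ zero (a + b)
merge φ (suc n) a b = φ (suc n) (a + b) + Σ< a (λ j → Σ< b (λ k → merge φ n (suc j) (suc k)))

merge-cong : ∀ {φ χ} → (∀ n a → φ n a ≡ χ n a) → ∀ n a b → merge φ n a b ≡ merge χ n a b
merge-cong h zero    a b = h 0 (a + b)
merge-cong h (suc n) a b = cong₂ _+_ (h (suc n) (a + b))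
  (Σ<-cong a λ j → Σ<-cong b λ k → merge-cong h n (suc j) (suc k))

chains-merge : ∀ φ n a q b → chains (λ n a q b → φ n (a + b)) n a q b ≡ merge φ n a b
chains-merge φ zero    a q b = refl
chains-merge φ (suc n) a q b = cong (φ (suc n) (a + b) +_)
  (Σ<-cong a λ j → trans (Σ≡-cong b λ l k _ → chains-merge φ n (suc j) (q + l) (suc k)) (Σ≡-reverse b _))

merge-comm : ∀ φ n a b → merge φ n a b ≡ merge φ n b a
merge-comm φ zero    a b = cong (φ 0) (+-comm a b)
merge-comm φ (suc n) a b = cong₂ _+_ (cong (φ (suc n)) (+-comm a b))
  (trans (Σ<-swap a b (λ j k → merge φ n (suc j) (suc k))) (Σ<-cong b λ k → Σ<-cong a λ j → merge-comm φ n (suc j) (suc k)))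

module _ (φ : ℕ → ℕ → ℕ) where
  open ≡-Reasoning

  private
    mergeˡ mergeʳ : (n a b c : ℕ) → ℕ
    mergeˡ n a b c = merge (λ n f → merge φ n f c) n a b
    mergeʳ n a b c = merge (λ n f → merge φ n a f) n b c

    -- This and `mergeʳ-drop` collect the terms whose outer chain makes at least one step.
    mergeˡ-drop : ℕ → ℕ → ℕ → ℕ → ℕ
    mergeˡ-drop n a b c = delay (λ n → Σ< a λ j → Σ< b λ k → mergeˡ n (suc j) (suc k) c) n

    mergeʳ-drop : ℕ → ℕ → ℕ → ℕ → ℕ
    mergeʳ-drop n a b c = delay (λ n → Σ< b λ k → Σ< c λ l → mergeʳ n a (suc k) (suc l)) n

    mergeˡ-unfold : ∀ n a b c → mergeˡ n a b c ≡ merge φ n (a + b) c + mergeˡ-drop n a b c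
    mergeˡ-unfold zero    a b c = sym (+-identityʳ _)
    mergeˡ-unfold (suc n) a b c = refl

    mergeʳ-unfold : ∀ n a b c → mergeʳ n a b c ≡ merge φ n a (b + c) + mergeʳ-drop n a b c
    mergeʳ-unfold zero    a b c = sym (+-identityʳ _)
    mergeʳ-unfold (suc n) a b c = refl

  -- The chains on both sides are compared after two steps: expanding each side
  -- once, applying the induction hypothesis and expanding again leaves the
  -- same three double sums and the same triple sum.
  merge-assoc : ∀ n a b c → mergeˡ n a b c ≡ mergeʳ n a b c
  merge-assoc-drop : ∀ n a b c →
    Σ< a (λ j → Σ< b λ k → mergeʳ-drop n (suc j) (suc k) c) ≡
    Σ< b (λ k → Σ< c λ l → mergeˡ-drop n a (suc k) (suc l))

  merge-assoc zero    a b c = cong (φ 0) (+-assoc a b c)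
  merge-assoc (suc n) a b c = begin
    φ (suc n) (a + b + c) + Σ< (a + b) (λ j → Σ< c λ l → M (suc j) (suc l)) +
      Σ< a (λ j → Σ< b λ k → mergeˡ n (suc j) (suc k) c)
      ≡⟨ cong₂ (λ x y → φ (suc n) x + y + Σ< a (λ j → Σ< b λ k → mergeˡ n (suc j) (suc k) c))
           (+-assoc a b c) (Σ<-split a b _) ⟩
    P + (S₁ + S₂) + Σ< a (λ j → Σ< b λ k → mergeˡ n (suc j) (suc k) c)
      ≡⟨ cong (P + (S₁ + S₂) +_) (trans
           (Σ<-cong a λ j → trans (Σ<-cong b λ k → trans (merge-assoc n (suc j) (suc k) c) (mergeʳ-unfold n (suc j) (suc k) c)) (Σ<-+ b _ _))
           (Σ<-+ a _ _)) ⟩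
    P + (S₁ + S₂) + (Σ< a (λ j → Σ< b λ k → M (suc j) (suc k + c)) + Σ< a (λ j → Σ< b λ k → mergeʳ-drop n (suc j) (suc k) c))
      ≡⟨ cong₂ (λ x y → P + (S₁ + S₂) + (x + y))
           (Σ<-cong a λ j → Σ<-cong b λ k → cong (M (suc j)) (cong suc (+-comm k c)))
           (merge-assoc-drop n a b c) ⟩
    P + (S₁ + S₂) + (S₃ + T)
      ≡⟨ lemma P S₁ S₂ S₃ T ⟩
    P + (S₁ + S₃) + (S₂ + T)
      ≡⟨ cong₂ (λ x y → P + x + (y + T)) (Σ<-+ a _ _)
           (Σ<-cong b λ k → Σ<-cong c λ l → cong (λ z → M z (suc l)) (+-suc a k)) ⟨
    P + Σ< a (λ j → Σ< c (λ l → M (suc j) (suc l)) + Σ< b (λ k → M (suc j) (suc (c + k)))) +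
      (Σ< b (λ k → Σ< c λ l → M (a + suc k) (suc l)) + T)
      ≡⟨ cong₂ (λ x y → P + x + y)
           (Σ<-cong a λ j → trans (cong (λ z → Σ< z (λ l → M (suc j) (suc l))) (+-comm b c)) (Σ<-split c b _))
           (trans (Σ<-cong b λ k → trans (Σ<-cong c λ l → trans (sym (merge-assoc n a (suc k) (suc l))) (mergeˡ-unfold n a (suc k) (suc l))) (Σ<-+ c _ _))
                  (Σ<-+ b _ _)) ⟨
    P + Σ< a (λ j → Σ< (b + c) λ l → M (suc j) (suc l)) +
      Σ< b (λ k → Σ< c λ l → mergeʳ n a (suc k) (suc l)) ∎
    where
    M : ℕ → ℕ → ℕ
    M = merge φ n
    P S₁ S₂ S₃ T : ℕ
    P  = φ (suc n) (a + (b + c))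
    S₁ = Σ< a (λ j → Σ< c λ l → M (suc j) (suc l))
    S₂ = Σ< b (λ j → Σ< c λ l → M (suc (a + j)) (suc l))
    S₃ = Σ< a (λ j → Σ< b λ k → M (suc j) (suc (c + k)))
    T  = Σ< b (λ k → Σ< c λ l → mergeˡ-drop n a (suc k) (suc l))
    lemma : ∀ p x y z w → p + (x + y) + (z + w) ≡ p + (x + z) + (y + w)
    lemma p x y z w = begin
      p + (x + y) + (z + w)   ≡⟨ +-assoc p _ _ ⟩
      p + (x + y + (z + w))   ≡⟨ cong (p +_) (interchange x y z w) ⟩
      p + (x + z + (y + w))   ≡⟨ +-assoc p _ _ ⟨
      p + (x + z) + (y + w)   ∎

  merge-assoc-drop zero    a b c =
    trans (trans (Σ<-cong a λ _ → Σ<-0 b) (Σ<-0 a)) (sym (trans (Σ<-cong b λ _ → Σ<-0 c) (Σ<-0 b)))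
  merge-assoc-drop (suc n) a b c = begin
    -- On both sides `b` drops twice, once together with `a` and once together with `c`, in opposite
    -- orders. The range is always `j < a`, `k′ ≤ k < b`, `l < c`.
    Σ< a (λ j → Σ< b λ k → Σ< (suc k) λ k′ → Σ< c λ l → mergeʳ n (suc j) (suc k′) (suc l))
      ≡⟨ Σ<-swap a b (λ j k → Σ< (suc k) λ k′ → R j k′) ⟩
    Σ< b (λ k → Σ< a λ j → Σ< (suc k) λ k′ → Σ< c λ l → mergeʳ n (suc j) (suc k′) (suc l))
      ≡⟨ (Σ<-cong b λ k → begin
           Σ< a (λ j → Σ< (suc k) λ k′ → Σ< c λ l → mergeʳ n (suc j) (suc k′) (suc l))
             ≡⟨ (Σ<-cong a λ j → Σ<-swap (suc k) c (λ k′ l → mergeʳ n (suc j) (suc k′) (suc l))) ⟩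
           Σ< a (λ j → Σ< c λ l → Σ< (suc k) λ k′ → mergeʳ n (suc j) (suc k′) (suc l))
             ≡⟨ Σ<-swap a c (λ j l → Σ< (suc k) λ k′ → mergeʳ n (suc j) (suc k′) (suc l)) ⟩
           Σ< c (λ l → Σ< a λ j → Σ< (suc k) λ k′ → mergeʳ n (suc j) (suc k′) (suc l))
             ≡⟨ (Σ<-cong c λ l → Σ<-cong a λ j → Σ<-cong (suc k) λ k′ → merge-assoc n (suc j) (suc k′) (suc l)) ⟨
           Σ< c (λ l → Σ< a λ j → Σ< (suc k) λ k′ → mergeˡ n (suc j) (suc k′) (suc l)) ∎) ⟩
    Σ< b (λ k → Σ< c λ l → Σ< a λ j → Σ< (suc k) λ k′ → mergeˡ n (suc j) (suc k′) (suc l)) ∎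
    where
    R : ℕ → ℕ → ℕ
    R j k′ = Σ< c λ l → mergeʳ n (suc j) (suc k′) (suc l)

-- Paths and the insertion of repetitions

-- A branching process: `∑ s f` is the sum of f over the successors of s.
record System : Set₁ where
  field
    State  : Set
    ∑      : State → (State → ℕ) → ℕ
    ∑-cong : ∀ s {f g} → (∀ t → f t ≡ g t) → ∑ s f ≡ ∑ s g
    ∑-+    : ∀ s f g → ∑ s (λ t → f t + g t) ≡ ∑ s f + ∑ s g
    ∑-0    : ∀ s → ∑ s (λ _ → 0) ≡ 0

Weight : Set → Set
Weight S = ℕ → S → ℕ

module Walks (𝒮 : System) where
  open System 𝒮

  -- The sum, over all walks from s of length at most n, of the weight of the
  -- end of the walk, taken at the remaining budget.
  walks : Weight State → ℕ → State → ℕ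
  walks φ zero    s = φ zero s
  walks φ (suc n) s = φ (suc n) s + ∑ s (walks φ n)

  extend : Weight State → Weight State
  extend φ n s = delay (λ n′ → ∑ s (φ n′)) n

  walks-cong : ∀ {φ χ} n → (∀ n′ s → n′ ≤ n → φ n′ s ≡ χ n′ s) → ∀ s → walks φ n s ≡ walks χ n s
  walks-cong zero    h s = h 0 s z≤n
  walks-cong (suc n) h s = cong₂ _+_ (h (suc n) s ≤-refl)
    (∑-cong s (walks-cong n λ n′ t n′≤n → h n′ t (m≤n⇒m≤1+n n′≤n)))

  walks-+ : ∀ φ χ n s → walks (λ n s → φ n s + χ n s) n s ≡ walks φ n s + walks χ n s
  walks-+ φ χ zero    s = refl
  walks-+ φ χ (suc n) s =
    trans (cong (φ (suc n) s + χ (suc n) s +_) (trans (∑-cong s (walks-+ φ χ n)) (∑-+ s (walks φ n) (walks χ n))))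
          (interchange (φ (suc n) s) (χ (suc n) s) (∑ s (walks φ n)) (∑ s (walks χ n)))

  walks-0 : ∀ n s → walks (λ _ _ → 0) n s ≡ 0
  walks-0 zero    s = refl
  walks-0 (suc n) s = trans (∑-cong s (walks-0 n)) (∑-0 s)

  walks-vanish : ∀ φ n s → (∀ n′ t → n′ ≤ n → φ n′ t ≡ 0) → walks φ n s ≡ 0
  walks-vanish φ n s h = trans (walks-cong n h s) (walks-0 n s)

  -- The last step of a nonempty walk is absorbed into the weight, whereas `walks` recurses on the
  -- first step.
  walks-extend : ∀ φ n s → walks φ n s ≡ φ n s + walks (extend φ) n s
  walks-extend φ zero    s = sym (+-identityʳ _)
  walks-extend φ (suc n) s = cong (φ (suc n) s +_)
    (trans (∑-cong s (walks-extend φ n)) (∑-+ s (φ n) (walks (extend φ) n)))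

  -- Iterating the recurrence moves the weight beyond the budget.
  walks-unique : ∀ (X : Weight State → ℕ → ℕ) s →
    (∀ φ n → (∀ n′ t → n′ ≤ n → φ n′ t ≡ 0) → X φ n ≡ 0) →
    (∀ φ n → X φ n ≡ φ n s + X (extend φ) n) →
    ∀ φ n → X φ n ≡ walks φ n s
  walks-unique X s X-vanish X-extend φ n =
    -- `j` bounds the number of applications of `extend` after which the weight vanishes at all
    -- budgets up to `n`. At `suc n` the condition on the weight is void.
    go (suc n) φ (λ n′ t le → contradict (≤-trans (m≤n+m (suc n) n′) le))
    where
    contradict : ∀ {A : Set} → suc n ≤ n → A
    contradict le with () ← 1+n≰n le
    extend-vanish : ∀ j φ → (∀ n′ t → n′ + suc j ≤ n → φ n′ t ≡ 0) →
                    ∀ n′ t → n′ + j ≤ n → extend φ n′ t ≡ 0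
    extend-vanish j φ h zero     t le = refl
    extend-vanish j φ h (suc n′) t le =
      trans (∑-cong t (λ u → h n′ u (≤-trans (≤-reflexive (+-suc n′ j)) le))) (∑-0 t)
    go : ∀ j φ → (∀ n′ t → n′ + j ≤ n → φ n′ t ≡ 0) → X φ n ≡ walks φ n s
    go zero    φ h = trans (X-vanish φ n h′) (sym (walks-vanish φ n s h′))
      where
      h′ : ∀ n′ t → n′ ≤ n → φ n′ t ≡ 0
      h′ n′ t le = h n′ t (≤-trans (≤-reflexive (+-identityʳ n′)) le)
    go (suc j) φ h = begin
      X φ n                          ≡⟨ X-extend φ n ⟩
      φ n s + X (extend φ) n         ≡⟨ cong (φ n s +_) (go j (extend φ) (extend-vanish j φ h)) ⟩
      φ n s + walks (extend φ) n s   ≡⟨ walks-extend φ n s ⟨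
      walks φ n s                    ∎
      where open ≡-Reasoning

  walksUntil : (State → Bool) → Weight State → ℕ → State → ℕ
  walksUntil b ψ zero    s = if b s then ψ zero s else 0
  walksUntil b ψ (suc n) s = if b s then ψ (suc n) s else ∑ s (walksUntil b ψ n)

  walksUntil-cong : ∀ b {φ χ} → (∀ n s → φ n s ≡ χ n s) → ∀ n s → walksUntil b φ n s ≡ walksUntil b χ n s
  walksUntil-cong b h zero    s with b s
  ... | true  = h 0 s
  ... | false = refl
  walksUntil-cong b h (suc n) s with b s
  ... | true  = h (suc n) s
  ... | false = ∑-cong s (walksUntil-cong b h n)

  -- First-passage decomposition: a walk of nonzero weight ends where `b` holds, so it meets a first
  -- such state and continues freely from there.
  walks-walksUntil : ∀ b φ → (∀ n s → b s ≡ false → φ n s ≡ 0) →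
                ∀ n s → walks φ n s ≡ walksUntil b (walks φ) n s
  walks-walksUntil b φ h zero    s with b s in eq
  ... | true  = refl
  ... | false = h 0 s eq
  walks-walksUntil b φ h (suc n) s with b s in eq
  ... | true  = refl
  ... | false = cong₂ _+_ (h (suc n) s eq) (∑-cong s (walks-walksUntil b φ h n))

-- Steps to a level k ≤ ht p; the most recent level comes first.
Path : Set
Path = List ℕ

-- Levels are numbered from 0 while heights count open letters, so a step to level `k` leaves
-- `k + 1` letters open.
ht : Path → ℕ
ht []      = 0
ht (k ∷ p) = suc k

paths : System
paths = record
  { State  = Path
  ; ∑      = λ p f → Σ< (suc (ht p)) (λ k → f (k ∷ p))
  ; ∑-cong = λ p h → Σ<-cong (suc (ht p)) (λ k → h (k ∷ p))
  ; ∑-+    = λ p f g → Σ<-+ (suc (ht p)) (λ k → f (k ∷ p)) (λ k → g (k ∷ p))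
  ; ∑-0    = λ p → Σ<-0 (suc (ht p))
  }

open Walks paths

walksUntil-Σ< : ∀ b m (f : ℕ → ℕ → Path → ℕ) n s →
  walksUntil b (λ n s → Σ< m (λ i → f i n s)) n s ≡ Σ< m (λ i → walksUntil b (f i) n s)
walksUntil-Σ< b m f zero    s with b s
... | true  = refl
... | false = sym (Σ<-0 m)
walksUntil-Σ< b m f (suc n) s with b s
... | true  = refl
... | false = trans (Σ<-cong (suc (ht s)) (λ k → walksUntil-Σ< b m f n (k ∷ s)))
                    (Σ<-swap (suc (ht s)) m (λ k i → walksUntil b (f i) n (k ∷ s)))

walksUntil-unfold : ∀ b ψ n s → walksUntil b ψ n s ≡
  (if b s then ψ n s else delay (λ n → Σ< (suc (ht s)) (λ k → walksUntil b ψ n (k ∷ s))) n)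
walksUntil-unfold b ψ zero    s = refl
walksUntil-unfold b ψ (suc n) s = refl

walksUntil-delay : ∀ b (f : ℕ → Path → ℕ) n s →
  walksUntil b (λ n s → delay (λ n′ → f n′ s) n) n s ≡ delay (λ n′ → walksUntil b f n′ s) n
walksUntil-delay b f zero    s with b s
... | true  = refl
... | false = refl
walksUntil-delay b f (suc n) s = trans (by-cases (b s)) (sym (walksUntil-unfold b f n s))
  where
  by-cases : ∀ c →
    (if c then f n s else Σ< (suc (ht s)) (λ k → walksUntil b (λ n s → delay (λ n′ → f n′ s) n) n (k ∷ s))) ≡
    (if c then f n s else delay (λ n → Σ< (suc (ht s)) (λ k → walksUntil b f n (k ∷ s))) n)
  by-cases true  = refl
  by-cases false = trans (Σ<-cong (suc (ht s)) (λ k → walksUntil-delay b f n (k ∷ s))) (Σ<-delay n)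
    where
    Σ<-delay : ∀ n → Σ< (suc (ht s)) (λ k → delay (λ n → walksUntil b f n (k ∷ s)) n) ≡
                     delay (λ n → Σ< (suc (ht s)) (λ k → walksUntil b f n (k ∷ s))) n
    Σ<-delay zero    = Σ<-0 (suc (ht s))
    Σ<-delay (suc n) = refl

-- Two independent walks share one budget, and what they leave for `ψ` does not depend on which of
-- them runs first.
walksUntil-comm : ∀ b c (ψ : Path → ℕ → Path → ℕ) n s t →
  walksUntil b (λ n u → walksUntil c (ψ u) n t) n s ≡ walksUntil c (λ n v → walksUntil b (λ n u → ψ u n v) n s) n t
walksUntil-comm b c ψ zero s t with b s
... | true  = refl
... | false with c t
...   | true  = refl
...   | false = refl
walksUntil-comm b c ψ (suc n) s t =
  trans (by-cases (b s)) (sym (walksUntil-cong c (λ n v → walksUntil-unfold b (λ n u → ψ u n v) n s) (suc n) t))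
  where
  open ≡-Reasoning
  next : ℕ → Path → ℕ
  next n v = Σ< (suc (ht s)) (λ k → walksUntil b (λ n u → ψ u n v) n (k ∷ s))
  by-cases : ∀ x →
    (if x then walksUntil c (ψ s) (suc n) t
          else Σ< (suc (ht s)) (λ k → walksUntil b (λ n u → walksUntil c (ψ u) n t) n (k ∷ s))) ≡
    walksUntil c (λ n v → if x then ψ s n v else delay (λ n → next n v) n) (suc n) t
  by-cases true  = refl
  by-cases false = begin
    Σ< (suc (ht s)) (λ k → walksUntil b (λ n u → walksUntil c (ψ u) n t) n (k ∷ s))
      ≡⟨ Σ<-cong (suc (ht s)) (λ k → walksUntil-comm b c ψ n (k ∷ s) t) ⟩
    Σ< (suc (ht s)) (λ k → walksUntil c (λ n v → walksUntil b (λ n u → ψ u n v) n (k ∷ s)) n t)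
      ≡⟨ walksUntil-Σ< c (suc (ht s)) (λ k n v → walksUntil b (λ n u → ψ u n v) n (k ∷ s)) n t ⟨
    walksUntil c next n t
      ≡⟨ walksUntil-delay c next (suc n) t ⟨
    walksUntil c (λ n v → delay (λ n → next n v) n) (suc n) t ∎

-- (i , q , k , W): the part of a path above a fixed prefix u.  Of the letters
-- open after u, i are still open; W is the path of the letters that do not
-- occur in u, of height q + k - 1, and its top k - 1 levels are still open.
Insertion : Set
Insertion = ℕ × ℕ × ℕ × Path

-- The first sum repeats a letter of u. This closes all open letters of W, so the cut moves up to
-- `ht W`. The second sum writes a letter of W at level `q + r`, which leaves `r + 1` levels open
-- above the cut.
insertions : System
insertions = record
  { State  = Insertion
  ; ∑      = λ { (i , q , k , W) f →
      Σ< i (λ j → f (suc j , ht W , 1 , W)) + Σ< k (λ r → f (i , q , suc (suc r) , (q + r) ∷ W)) }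
  ; ∑-cong = λ { (i , q , k , W) h → cong₂ _+_ (Σ<-cong i (λ j → h _)) (Σ<-cong k (λ r → h _)) }
  ; ∑-+    = λ { (i , q , k , W) f g → trans (cong₂ _+_ (Σ<-+ i (λ j → f (suc j , ht W , 1 , W)) (λ j → g (suc j , ht W , 1 , W)))
       (Σ<-+ k (λ r → f (i , q , suc (suc r) , (q + r) ∷ W)) (λ r → g (i , q , suc (suc r) , (q + r) ∷ W))))
       (interchange (Σ< i (λ j → f (suc j , ht W , 1 , W))) (Σ< i (λ j → g (suc j , ht W , 1 , W)))
          (Σ< k (λ r → f (i , q , suc (suc r) , (q + r) ∷ W))) (Σ< k (λ r → g (i , q , suc (suc r) , (q + r) ∷ W)))) }
  ; ∑-0    = λ { (i , q , k , W) → cong₂ _+_ (Σ<-0 i) (Σ<-0 k) }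
  }

module Ins = Walks insertions

-- The letters of a path above u are its new letters, which form a path W, and
-- returns to letters of u, which cut W between components: chains record the cuts.
walks-insertion : ∀ d ψ n →
  walks (λ n W → chains (λ n i q k → ψ n (i , q , k , W)) n d 0 (suc (ht W))) n [] ≡
  Ins.walks ψ n (d , 0 , 1 , [])
walks-insertion d = Ins.walks-unique X start vanish step
  where
  open ≡-Reasoning
  start : Insertion
  start = d , 0 , 1 , []
  X : Weight Insertion → ℕ → ℕ
  X ψ n = walks (λ n W → chains (λ n i q k → ψ n (i , q , k , W)) n d 0 (suc (ht W))) n []
  vanish : ∀ ψ n → (∀ n′ s → n′ ≤ n → ψ n′ s ≡ 0) → X ψ n ≡ 0
  vanish ψ n h = walks-vanish _ n [] λ n′ W n′≤n →
    trans (chains-cong n′ (λ n″ i q k n″≤n′ → h n″ _ (≤-trans n″≤n′ n′≤n)) d 0 (suc (ht W)))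
          (chains-0 n′ d 0 (suc (ht W)))
  step : ∀ ψ n → X ψ n ≡ ψ n start + X (Ins.extend ψ) n
  step ψ n = begin
    X ψ n
      -- Sorting by the last letter: in `old` it repeats a letter of u; in `A` it is the last letter
      -- of W, or there is none. `walks-extend` then removes that letter from W and turns `A` into
      -- `ψ n start` and `new`.
      ≡⟨ walks-cong n (λ n W _ → chains-last (λ n i q k → ψ n (i , q , k , W)) n d 0 (ht W) (ht W) refl) [] ⟩
    walks (λ n W → A n W + old n W) n []
      ≡⟨ walks-+ A old n [] ⟩
    walks A n [] + walks old n []
      ≡⟨ cong (_+ walks old n []) (trans (walks-extend A n []) (cong₂ _+_ (chains-b0 _ n d 0) (walks-cong n A-extend []))) ⟩
    ψ n start + walks new n [] + walks old n []
      ≡⟨ +-assoc (ψ n start) _ _ ⟩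
    ψ n start + (walks new n [] + walks old n [])
      ≡⟨ cong (ψ n start +_) (trans (+-comm (walks new n []) _) (sym (walks-+ old new n []))) ⟩
    ψ n start + walks (λ n W → old n W + new n W) n []
      ≡⟨ cong (ψ n start +_) (walks-cong n both []) ⟩
    ψ n start + X (Ins.extend ψ) n ∎
    where
    A old new : Weight Path
    A n W = chains (λ n i q k → ψ n (i , q , suc k , W)) n d 0 (ht W)
    old n W = chains (λ n i q k → delay (λ n′ → Σ< i (λ j → ψ n′ (suc j , ht W , 1 , W))) n) n d 0 (suc (ht W))
    new n W = chains (λ n i q k → delay (λ n′ → Σ< k (λ r → ψ n′ (i , q , suc (suc r) , (q + r) ∷ W))) n) n d 0 (suc (ht W))
    A-extend : ∀ n′ W → n′ ≤ n → extend A n′ W ≡ new n′ W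
    A-extend n′ W _ = begin
      delay (λ n′ → Σ< (suc (ht W)) (λ x → chains (λ n i q k → ψ n (i , q , suc k , x ∷ W)) n′ d 0 (suc x))) n′
        ≡⟨ delay-cong (λ n′ → sym (chains-diagonal (λ x n i q k → ψ n (i , q , suc k , x ∷ W)) n′ d 0 (suc (ht W)))) n′ ⟩
      delay (λ n′ → chains (λ n i q k → Σ< k (λ r → ψ n (i , q , suc (suc r) , (q + r) ∷ W))) n′ d 0 (suc (ht W))) n′
        ≡⟨ chains-delay (λ n i q k → Σ< k (λ r → ψ n (i , q , suc (suc r) , (q + r) ∷ W))) n′ d 0 (suc (ht W)) ⟨
      new n′ W ∎
    both : ∀ n′ W → n′ ≤ n → old n′ W + new n′ W ≡
      chains (λ n i q k → Ins.extend ψ n (i , q , k , W)) n′ d 0 (suc (ht W))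
    both n′ W _ = trans (sym (chains-+ _ _ n′ d 0 (suc (ht W))))
      (chains-cong n′ (λ { zero i q k _ → refl ; (suc n″) i q k _ → refl }) d 0 (suc (ht W)))

-- Pattern containment in words

OrderIsomorphic-sym : ∀ u v → OrderIsomorphic u v → OrderIsomorphic v u
OrderIsomorphic-sym u v (eq , h) = sym eq , λ i j →
  let h′ = h (cast (sym eq) i) (cast (sym eq) j) in
  mk⇔ (λ i<j → from h′ (subst₂ _<_ (back i) (back j) i<j))
      (λ i<j → subst₂ _<_ (sym (back i)) (sym (back j)) (to h′ i<j))
  where
  back : ∀ i → lookup v i ≡ lookup v (cast eq (cast (sym eq) i))
  back i = cong (lookup v) (sym (cast-involutive eq (sym eq) i))

OrderIsomorphic-trans : ∀ u v w → OrderIsomorphic u v → OrderIsomorphic v w → OrderIsomorphic u w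
OrderIsomorphic-trans u v w (eq , h) (eq′ , h′) = trans eq eq′ , λ i j →
  let hij = h i j ; hij′ = h′ (cast eq i) (cast eq j) in
  mk⇔ (λ i<j → subst₂ _<_ (fuse i) (fuse j) (to hij′ (to hij i<j)))
      (λ i<j → from hij (from hij′ (subst₂ _<_ (sym (fuse i)) (sym (fuse j)) i<j)))
  where
  fuse : ∀ i → lookup w (cast eq′ (cast eq i)) ≡ lookup w (cast (trans eq eq′) i)
  fuse i = cong (lookup w) (cast-trans eq eq′ i)

-- Order isomorphism by a list of matched letters, which is stable under
-- concatenation and splitting.
Matching : List ℕ → List ℕ → Set
Matching u v = ∃[ zs ] (map proj₁ zs ≡ u × map proj₂ zs ≡ v ×
  (∀ {x y} → x ∈ zs → y ∈ zs → (proj₁ x < proj₁ y) ⇔ (proj₂ x < proj₂ y)))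

matching : ∀ u v → OrderIsomorphic u v → Matching u v
matching u v (eq , h) = zip u v , fst u v eq , snd u v eq , λ {x} {y} x∈ y∈ →
  let (i , x≡) = index u v eq x∈ ; (j , y≡) = index u v eq y∈ in
  subst₂ (λ x y → (proj₁ x < proj₁ y) ⇔ (proj₂ x < proj₂ y)) (sym x≡) (sym y≡) (h i j)
  where
  fst : ∀ u v → length u ≡ length v → map proj₁ (zip u v) ≡ u
  fst []      []      eq = refl
  fst (x ∷ u) (y ∷ v) eq = cong (x ∷_) (fst u v (suc-injective eq))
  snd : ∀ u v → length u ≡ length v → map proj₂ (zip u v) ≡ v
  snd []      []      eq = refl
  snd (x ∷ u) (y ∷ v) eq = cong (y ∷_) (snd u v (suc-injective eq))
  index : ∀ u v (eq : length u ≡ length v) {z} → z ∈ zip u v →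
          ∃[ i ] z ≡ (lookup u i , lookup v (cast eq i))
  index (x ∷ u) (y ∷ v) eq (here z≡)  = zero , z≡
  index (x ∷ u) (y ∷ v) eq (there z∈) = let (i , z≡) = index u v (suc-injective eq) z∈ in suc i , z≡

unmatching : ∀ {u v} → Matching u v → OrderIsomorphic u v
unmatching (zs , refl , refl , h) = eq , λ i j → h (at zs eq i) (at zs eq j)
  where
  eq : length (map proj₁ zs) ≡ length (map proj₂ zs)
  eq = trans (length-map proj₁ zs) (sym (length-map proj₂ zs))
  at : ∀ zs (eq : length (map proj₁ zs) ≡ length (map proj₂ zs)) i →
       (lookup (map proj₁ zs) i , lookup (map proj₂ zs) (cast eq i)) ∈ zs
  at (z ∷ zs) eq zero    = here refl
  at (z ∷ zs) eq (suc i) = there (at zs (suc-injective eq) i)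

OrderIsomorphic-shift : ∀ m u → OrderIsomorphic (map (m +_) u) u
OrderIsomorphic-shift m u = unmatching
  ( map (λ x → m + x , x) u
  , sym (map-∘ u) , trans (sym (map-∘ u)) (map-id u)
  , λ x∈ y∈ → mono (∈-map⁻ _ x∈) (∈-map⁻ _ y∈))
  where
  mono : ∀ {x y} → ∃[ a ] (a ∈ u × x ≡ (m + a , a)) → ∃[ a ] (a ∈ u × y ≡ (m + a , a)) →
         (proj₁ x < proj₁ y) ⇔ (proj₂ x < proj₂ y)
  mono (a , _ , refl) (b , _ , refl) = mk⇔ (+-cancelˡ-< m a b) (+-monoʳ-< m)

infix 4 _≺_
_≺_ : List ℕ → List ℕ → Set
u ≺ v = ∀ {x y} → x ∈ u → y ∈ v → x < y

OrderIsomorphic-++ : ∀ u u′ v v′ → OrderIsomorphic u v → OrderIsomorphic u′ v′ →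
                     u ≺ u′ → v ≺ v′ → OrderIsomorphic (u ++ u′) (v ++ v′)
OrderIsomorphic-++ u u′ v v′ o o′ u≺u′ v≺v′ with matching u v o | matching u′ v′ o′
... | zs , refl , refl , h | zs′ , refl , refl , h′ = unmatching
  (zs ++ zs′ , map-++ proj₁ zs zs′ , map-++ proj₂ zs zs′ , λ x∈ y∈ → mono (∈-++⁻ zs x∈) (∈-++⁻ zs y∈))
  where
  mono : ∀ {x y} → x ∈ zs ⊎ x ∈ zs′ → y ∈ zs ⊎ y ∈ zs′ → (proj₁ x < proj₁ y) ⇔ (proj₂ x < proj₂ y)
  mono (inj₁ x∈) (inj₁ y∈) = h x∈ y∈
  mono (inj₂ x∈) (inj₂ y∈) = h′ x∈ y∈
  mono (inj₁ x∈) (inj₂ y∈) = mk⇔ (λ _ → v≺v′ (∈-map⁺ proj₂ x∈) (∈-map⁺ proj₂ y∈))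
                                 (λ _ → u≺u′ (∈-map⁺ proj₁ x∈) (∈-map⁺ proj₁ y∈))
  mono (inj₂ x∈) (inj₁ y∈) =
    mk⇔ (λ lt → contradiction lt (<-asym (u≺u′ (∈-map⁺ proj₁ y∈) (∈-map⁺ proj₁ x∈))))
        (λ lt → contradiction lt (<-asym (v≺v′ (∈-map⁺ proj₂ y∈) (∈-map⁺ proj₂ x∈))))

map-++⁻ : ∀ {A B : Set} (f : A → B) zs u {v} → map f zs ≡ u ++ v →
          ∃[ xs ] ∃[ ys ] (zs ≡ xs ++ ys × map f xs ≡ u × map f ys ≡ v)
map-++⁻ f zs       []      eq = [] , zs , refl , refl , eq
map-++⁻ f (z ∷ zs) (x ∷ u) eq =
  let (xs , ys , zs≡ , u≡ , v≡) = map-++⁻ f zs u (proj₂ (∷-injective eq)) in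
  z ∷ xs , ys , cong (z ∷_) zs≡ , cong₂ _∷_ (proj₁ (∷-injective eq)) u≡ , v≡

OrderIsomorphic-++⁻ : ∀ w v v′ → OrderIsomorphic w (v ++ v′) → v ≺ v′ →
  ∃[ u ] ∃[ u′ ] (w ≡ u ++ u′ × OrderIsomorphic u v × OrderIsomorphic u′ v′ × u ≺ u′)
OrderIsomorphic-++⁻ w v v′ o v≺v′ with matching w (v ++ v′) o
... | zs , refl , eq , h with map-++⁻ proj₂ zs v eq
...   | xs , ys , refl , refl , refl =
  map proj₁ xs , map proj₁ ys , map-++ proj₁ xs ys ,
  unmatching (xs , refl , refl , λ x∈ y∈ → h (∈-++⁺ˡ x∈) (∈-++⁺ˡ y∈)) ,
  unmatching (ys , refl , refl , λ x∈ y∈ → h (∈-++⁺ʳ xs x∈) (∈-++⁺ʳ xs y∈)) ,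
  λ x∈ y∈ → below (∈-map⁻ proj₁ x∈) (∈-map⁻ proj₁ y∈)
  where
  below : ∀ {x y} → ∃[ a ] (a ∈ xs × x ≡ proj₁ a) → ∃[ b ] (b ∈ ys × y ≡ proj₁ b) → x < y
  below (a , a∈ , refl) (b , b∈ , refl) =
    from (h (∈-++⁺ˡ a∈) (∈-++⁺ʳ xs b∈)) (v≺v′ (∈-map⁺ proj₂ a∈) (∈-map⁺ proj₂ b∈))

infix 4 _⊒_
_⊒_ : List ℕ → List ℕ → Set
w ⊒ s = ∃[ v ] (v ⊆ w × OrderIsomorphic v s)

⇔-dec : ∀ {A B : Set} → Dec A → Dec B → Dec (A ⇔ B)
⇔-dec a? b? = map′ (λ (f , g) → mk⇔ f g) (λ e → to e , from e) ((a? →-dec b?) ×-dec (b? →-dec a?))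

OrderIsomorphic? : ∀ u v → Dec (OrderIsomorphic u v)
OrderIsomorphic? u v with length u ≟ length v
... | no  ≢  = no (λ (eq , _) → ≢ eq)
... | yes eq = map′ (eq ,_) (λ (_ , h) → h)
  (all? λ i → all? λ j → ⇔-dec (lookup u i <? lookup u j) (lookup v (cast eq i) <? lookup v (cast eq j)))

anySublist? : ∀ {Q : List ℕ → Set} → (∀ v → Dec (Q v)) → ∀ w → Dec (∃[ v ] (v ⊆ w × Q v))
anySublist? Q? []      = map′ (λ q → [] , [] , q) (λ { ([] , [] , q) → q }) (Q? [])
anySublist? Q? (x ∷ w) = map′
  (λ { (inj₁ (v , v⊆w , q)) → v , x ∷ˢ v⊆w , q ; (inj₂ (v , v⊆w , q)) → x ∷ v , refl ∷ v⊆w , q })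
  (λ { (v , _ ∷ˢ v⊆w , q) → inj₁ (v , v⊆w , q) ; (_ ∷ v , refl ∷ v⊆w , q) → inj₂ (v , v⊆w , q) })
  (anySublist? Q? w ⊎-dec anySublist? (Q? ∘ (x ∷_)) w)

infix 4 _⊒?_
_⊒?_ : ∀ w s → Dec (w ⊒ s)
w ⊒? s = anySublist? (λ v → OrderIsomorphic? v s) w

++⊆⁻ : ∀ {A : Set} (u : List A) {v w} → u ++ v ⊆ w → ∃[ w₁ ] ∃[ w₂ ] (w ≡ w₁ ++ w₂ × u ⊆ w₁ × v ⊆ w₂)
++⊆⁻ []      {w = w} s = [] , w , refl , [] , s
++⊆⁻ (x ∷ u) (y ∷ˢ s) =
  let (w₁ , w₂ , eq , s₁ , s₂) = ++⊆⁻ (x ∷ u) s in y ∷ w₁ , w₂ , cong (y ∷_) eq , y ∷ˢ s₁ , s₂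
++⊆⁻ (x ∷ u) (refl ∷ s) =
  let (w₁ , w₂ , eq , s₁ , s₂) = ++⊆⁻ u s in x ∷ w₁ , w₂ , cong (x ∷_) eq , refl ∷ s₁ , s₂

⊆++⁻ : ∀ {A : Set} {v : List A} w₁ {w₂} → v ⊆ w₁ ++ w₂ →
       ∃[ v₁ ] ∃[ v₂ ] (v ≡ v₁ ++ v₂ × v₁ ⊆ w₁ × v₂ ⊆ w₂)
⊆++⁻ []       s = [] , _ , refl , [] , s
⊆++⁻ (x ∷ w₁) (_ ∷ˢ s) =
  let (v₁ , v₂ , eq , s₁ , s₂) = ⊆++⁻ w₁ s in v₁ , v₂ , eq , x ∷ˢ s₁ , s₂
⊆++⁻ (x ∷ w₁) (refl ∷ s) =
  let (v₁ , v₂ , eq , s₁ , s₂) = ⊆++⁻ w₁ s in x ∷ v₁ , v₂ , cong (x ∷_) eq , refl ∷ s₁ , s₂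

⊆map⁻ : ∀ {A B : Set} (f : A → B) w {v} → v ⊆ map f w → ∃[ u ] (v ≡ map f u × u ⊆ w)
⊆map⁻ f []      []         = [] , refl , []
⊆map⁻ f (x ∷ w) (_ ∷ˢ s)   = let (u , eq , s′) = ⊆map⁻ f w s in u , eq , x ∷ˢ s′
⊆map⁻ f (x ∷ w) (refl ∷ s) = let (u , eq , s′) = ⊆map⁻ f w s in x ∷ u , cong (f x ∷_) eq , refl ∷ s′

⊆filter : ∀ m {v w} → v ⊆ w → All (m <_) v → v ⊆ filter (m <?_) w
⊆filter m {v} s m<v = subst (_⊆ _) (filter-all (m <?_) m<v) (filter⁺ (m <?_) (m <?_) (λ { refl m<x → m<x }) s)

++-split : ∀ {A : Set} (p : List A) {b} a {c} → p ++ b ≡ a ++ c →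
  (∃[ z ] p ≡ a ++ z) ⊎ (∃[ x ] ∃[ z ] (a ≡ p ++ x ∷ z × b ≡ x ∷ z ++ c))
++-split p       []      eq = inj₁ (p , refl)
++-split []      (x ∷ a) eq = inj₂ (x , a , refl , eq)
++-split (y ∷ p) (x ∷ a) eq with ∷-injective eq
... | refl , eq′ with ++-split p a eq′
...   | inj₁ (z , p≡)          = inj₁ (z , cong (y ∷_) p≡)
...   | inj₂ (x′ , z , a≡ , b≡) = inj₂ (x′ , z , cong (y ∷_) a≡ , b≡)

-- Restricted growth words and crossings

maxLetter-++ : ∀ u v → maxLetter (u ++ v) ≡ maxLetter u ⊔ maxLetter v
maxLetter-++ []      v = refl
maxLetter-++ (x ∷ u) v = trans (cong (x ⊔_) (maxLetter-++ u v)) (sym (⊔-assoc x (maxLetter u) (maxLetter v)))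

RGWFrom-++⁻ : ∀ {m} u {v} → RGWFrom m (u ++ v) → RGWFrom m u × RGWFrom (m ⊔ maxLetter u) v
RGWFrom-++⁻ {m} []      {v} g = [] , subst (λ k → RGWFrom k v) (sym (⊔-identityʳ m)) g
RGWFrom-++⁻ {m} (x ∷ u) {v} (cons a b g) =
  let (g₁ , g₂) = RGWFrom-++⁻ u g in
  cons a b g₁ , subst (λ k → RGWFrom k v) (⊔-assoc m x (maxLetter u)) g₂

-- `x` exceeds the maximum of `u` by at most one, and all positive letters up to that maximum occur
-- in `u`.
RGW-smaller : ∀ u {x v y} → RGWFrom 0 (u ++ x ∷ v) → 1 ≤ y → y < x → y ∈ u
RGW-smaller u g 1≤y y<x with RGWFrom-++⁻ u g
... | g₁ , cons _ x≤ _ = from (letters g₁ _) (1≤y , s≤s⁻¹ (≤-trans y<x x≤))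

Crossing : List ℕ → Set
Crossing w = ∃[ a ] ∃[ b ] (a < b × a ∷ b ∷ a ∷ b ∷ [] ⊆ w)

1212-word : List ℕ
1212-word = 1 ∷ 2 ∷ 1 ∷ 2 ∷ []

crossing⇒1212 : ∀ {w} → Crossing w → w ⊒ 1212-word
crossing⇒1212 (a , b , a<b , s) = _ , s , unmatching (zs , refl , refl , λ x∈ y∈ → mono (either x∈) (either y∈))
  where
  zs : List (ℕ × ℕ)
  zs = (a , 1) ∷ (b , 2) ∷ (a , 1) ∷ (b , 2) ∷ []
  either : ∀ {z} → z ∈ zs → z ≡ (a , 1) ⊎ z ≡ (b , 2)
  either (here eq)                         = inj₁ eq
  either (there (here eq))                 = inj₂ eq
  either (there (there (here eq)))         = inj₁ eq
  either (there (there (there (here eq)))) = inj₂ eq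
  mono : ∀ {x y} → x ≡ (a , 1) ⊎ x ≡ (b , 2) → y ≡ (a , 1) ⊎ y ≡ (b , 2) →
         (proj₁ x < proj₁ y) ⇔ (proj₂ x < proj₂ y)
  mono (inj₁ refl) (inj₁ refl) = mk⇔ (λ l → contradiction l (<-irrefl refl)) (λ l → contradiction l (<-irrefl refl))
  mono (inj₁ refl) (inj₂ refl) = mk⇔ (λ _ → s≤s (s≤s z≤n)) (λ _ → a<b)
  mono (inj₂ refl) (inj₁ refl) = mk⇔ (λ l → contradiction l (<-asym a<b)) (λ { (s≤s ()) })
  mono (inj₂ refl) (inj₂ refl) = mk⇔ (λ l → contradiction l (<-irrefl refl)) (λ l → contradiction l (<-irrefl refl))

1212⇒crossing : ∀ {w} → w ⊒ 1212-word → Crossing w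
1212⇒crossing (a ∷ b ∷ c ∷ d ∷ [] , s , refl , h)
  -- The first and third letters agree, and so do the second and fourth, because neither is smaller
  -- than the other.
  with ≤-antisym (≮⇒≥ (λ l → 1≮1 (to (h 2F 0F) l))) (≮⇒≥ (λ l → 1≮1 (to (h 0F 2F) l)))
     | ≤-antisym (≮⇒≥ (λ l → 2≮2 (to (h 3F 1F) l))) (≮⇒≥ (λ l → 2≮2 (to (h 1F 3F) l)))
  where
  open import Data.Fin.Patterns
  1≮1 : ¬ 1 < 1
  1≮1 (s≤s ())
  2≮2 : ¬ 2 < 2
  2≮2 (s≤s (s≤s ()))
... | refl | refl = a , b , from (h zero (suc zero)) (s≤s (s≤s z≤n)) , s

-- A letter f > e after e is new: otherwise e, being smaller, occurs before the
-- walksUntil f, and e f e f is a crossing.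
noncrossing-new : ∀ {w} u e v {f} → w ≡ u ++ e ∷ v → RGWFrom 0 w → ¬ Crossing w →
                  f ∈ v → e < f → maxLetter (u ∷ʳ e) < f
noncrossing-new u e v {f} refl g nc f∈v e<f with f ≤? maxLetter (u ∷ʳ e)
... | no  f≰ = ≰⇒> f≰
... | yes f≤ with ∈-++⁻ u (from (letters g′ f) (≤-trans (letter-≥1 g e∈w) (<⇒≤ e<f) , f≤))
  where
  g′ : RGWFrom 0 (u ∷ʳ e)
  g′ = proj₁ (RGWFrom-++⁻ (u ∷ʳ e) (subst (RGWFrom 0) (sym (++-assoc u (e ∷ []) v)) g))
  e∈w : e ∈ u ++ e ∷ v
  e∈w = ∈-++⁺ʳ u (here refl)
...   | inj₂ (here refl) = contradiction e<f (<-irrefl refl)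
...   | inj₁ f∈u with ∈-∃++ f∈u
...     | a , b , refl = contradiction (e , f , e<f , s) nc
  where
  w≡ : (a ++ f ∷ b) ++ e ∷ v ≡ a ++ f ∷ b ++ e ∷ v
  w≡ = ++-assoc a (f ∷ b) (e ∷ v)
  e∈a : e ∈ a
  e∈a = RGW-smaller a (subst (RGWFrom 0) w≡ g) (letter-≥1 g (∈-++⁺ʳ u (here refl))) e<f
  s : e ∷ f ∷ e ∷ f ∷ [] ⊆ (a ++ f ∷ b) ++ e ∷ v
  s = subst (_ ⊆_) (sym w≡) (++⁺ (from∈ e∈a) (refl ∷ ++⁺ (minimum b) (refl ∷ from∈ f∈v)))

-- Occurrences of a concatenation in a non-crossing word

≺-concat : ∀ {α β} → RGWFrom 0 β → α ≺ map (maxLetter α +_) β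
≺-concat {α} g {x} x∈ y∈ with ∈-map⁻ (maxLetter α +_) y∈
... | b , b∈ , refl = ≤-<-trans (letter-≤max x∈) (m<m+n (maxLetter α) (letter-≥1 g b∈))

-- `W` consists of the letters of `rest` that exceed those of `u`, shifted down. An occurrence of
-- `β` among them lies after and above any occurrence of `α` in `u`.
concat-⊒⁺ : ∀ {α β W rest u} → RGWFrom 0 β → RGWFrom 0 W →
  map (maxLetter u +_) W ≡ filter (maxLetter u <?_) rest →
  u ⊒ α → W ⊒ β → u ++ rest ⊒ α ++ map (maxLetter α +_) β
concat-⊒⁺ {α} {β} {W} {rest} {u} gβ gW W≡ (E , E⊆u , oE) (F , F⊆W , oF) =
  E ++ map (maxLetter u +_) F ,
  ++⁺ E⊆u (⊆-trans (map⁺ (maxLetter u +_) F⊆W) (⊆-trans (subst (_⊆ _) (sym W≡) ⊆-refl) (filter-⊆ (maxLetter u <?_) rest))) ,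
  OrderIsomorphic-++ E mF α rβ oE
    (OrderIsomorphic-trans mF F rβ (OrderIsomorphic-shift (maxLetter u) F)
      (OrderIsomorphic-trans F β rβ oF (OrderIsomorphic-sym rβ β (OrderIsomorphic-shift (maxLetter α) β))))
    below (≺-concat {α} gβ)
  where
  mF rβ : List ℕ
  mF = map (maxLetter u +_) F
  rβ = map (maxLetter α +_) β
  below : E ≺ mF
  below {x} x∈ y∈ with ∈-map⁻ (maxLetter u +_) y∈
  ... | b , b∈ , refl = ≤-<-trans (letter-≤max (∈-⊆ E⊆u x∈)) (m<m+n (maxLetter u) (letter-≥1 gW (∈-⊆ F⊆W b∈)))

-- Containment of `α` is kept as a separate hypothesis. Together with it, this makes the word the
-- shortest of its prefixes containing `α`, since containment passes to longer words.
data Minimal (α : List ℕ) : List ℕ → Set where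
  empty : Minimal α []
  snoc  : ∀ {p} x → ¬ (p ⊒ α) → Minimal α (p ∷ʳ x)

-- Let `e` be the last letter of the occurrence of `α`. By minimality it does not come before the
-- last letter of `u`. The letters matched with `β` are later and larger than `e`, so by
-- `noncrossing-new` they exceed everything up to `e`, in particular `maxLetter u`, and therefore
-- belong to `W`.
concat-⊒⁻ : ∀ {α β W rest u} → RGWFrom 0 β → RGWFrom 0 (u ++ rest) → ¬ Crossing (u ++ rest) →
  map (maxLetter u +_) W ≡ filter (maxLetter u <?_) rest →
  u ⊒ α → Minimal α u → u ++ rest ⊒ α ++ map (maxLetter α +_) β → W ⊒ β
concat-⊒⁻ {α} {β} {W} {rest} {u} gβ g nc W≡ u⊒α min (v , v⊆w , o)
  with OrderIsomorphic-++⁻ v α (map (maxLetter α +_) β) o (≺-concat {α} gβ)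
... | E , F , refl , oE , oF , E≺F = conclude (⊆map⁻ (maxLetter u +_) W (subst (F ⊆_) (sym W≡) (new min g nc u⊒α v⊆w)))
  where
  conclude : ∃[ F′ ] (F ≡ map (maxLetter u +_) F′ × F′ ⊆ W) → W ⊒ β
  conclude (F′ , refl , F′⊆W) = F′ , F′⊆W ,
    OrderIsomorphic-trans F′ F β (OrderIsomorphic-sym F F′ (OrderIsomorphic-shift (maxLetter u) F′))
      (OrderIsomorphic-trans F (map (maxLetter α +_) β) β oF (OrderIsomorphic-shift (maxLetter α) β))
  new : ∀ {u} → Minimal α u → RGWFrom 0 (u ++ rest) → ¬ Crossing (u ++ rest) → u ⊒ α →
        E ++ F ⊆ u ++ rest → F ⊆ filter (maxLetter u <?_) rest
  -- An empty `u` has maximum 0, below every letter.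
  new empty g nc u⊒α s = ⊆filter 0 F⊆rest (All.tabulate (λ f∈ → letter-≥1 g (∈-⊆ F⊆rest f∈)))
    where
    F⊆rest : F ⊆ rest
    F⊆rest = ⊆-trans (++⁺ˡ E ⊆-refl) s
  new (snoc {p} ℓ p⋣α) g nc u⊒α s with reverseView E
  ... | [] = contradiction ([] , minimum p , oE) p⋣α
  ... | E′ ∶ _ ∶ʳ e with ++⊆⁻ E′ (subst (_⊆ _) (++-assoc E′ (e ∷ []) F) s)
  ...   | w₁ , w₂ , eq , E′⊆w₁ , eF⊆w₂ with ++⊆⁻ (e ∷ []) eF⊆w₂
  ...     | y , w₃ , refl , e⊆y , F⊆w₃ with ∈-∃++ (to∈ e⊆y)
  ...       | y₁ , y₂ , refl = conclude′ (++-split p {ℓ ∷ rest} ((w₁ ++ y₁) ∷ʳ e) {y₂ ++ w₃} eq′)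
    where
    open ≡-Reasoning
    w≡ : (p ∷ʳ ℓ) ++ rest ≡ (w₁ ++ y₁) ++ e ∷ (y₂ ++ w₃)
    w≡ = trans eq (trans (cong (w₁ ++_) (++-assoc y₁ (e ∷ y₂) w₃)) (sym (++-assoc w₁ y₁ (e ∷ y₂ ++ w₃))))
    eq′ : p ++ ℓ ∷ rest ≡ ((w₁ ++ y₁) ∷ʳ e) ++ (y₂ ++ w₃)
    eq′ = trans (sym (++-assoc p (ℓ ∷ []) rest)) (trans w≡ (sym (++-assoc (w₁ ++ y₁) (e ∷ []) (y₂ ++ w₃))))
    E⊆ : E′ ∷ʳ e ⊆ (w₁ ++ y₁) ∷ʳ e
    E⊆ = ++⁺ (++⁺ʳ y₁ E′⊆w₁) ⊆-refl
    conclude′ : (∃[ z ] p ≡ ((w₁ ++ y₁) ∷ʳ e) ++ z) ⊎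
      (∃[ x ] ∃[ z ] ((w₁ ++ y₁) ∷ʳ e ≡ p ++ x ∷ z × ℓ ∷ rest ≡ x ∷ z ++ (y₂ ++ w₃))) →
      F ⊆ filter (maxLetter (p ∷ʳ ℓ) <?_) rest
    conclude′ (inj₁ (z , p≡)) = contradiction (E′ ∷ʳ e , subst (_ ⊆_) (sym p≡) (++⁺ʳ z E⊆) , oE) p⋣α
    conclude′ (inj₂ (.ℓ , z , w₁≡ , refl)) =
      ⊆filter _ (++⁺ˡ z (++⁺ˡ y₂ F⊆w₃)) (All.tabulate λ f∈ → ≤-<-trans u≤
        (noncrossing-new (w₁ ++ y₁) e (y₂ ++ w₃) w≡ g nc (∈-++⁺ʳ y₂ (∈-⊆ F⊆w₃ f∈)) (E≺F (∈-++⁺ʳ E′ (here refl)) f∈)))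
      where
      u≤ : maxLetter (p ∷ʳ ℓ) ≤ maxLetter ((w₁ ++ y₁) ∷ʳ e)
      u≤ = ≤-trans (m≤m⊔n (maxLetter (p ∷ʳ ℓ)) (maxLetter z)) (≤-reflexive (trans (sym (maxLetter-++ (p ∷ʳ ℓ) z))
        (cong maxLetter (trans (++-assoc p (ℓ ∷ []) z) (sym w₁≡)))))

-- Non-crossing words as paths

Valid : Path → Set
Valid []      = ⊤
Valid (k ∷ p) = k ≤ ht p × Valid p

-- lev p l is the letter written by a step from p to level l: for l < ht p the
-- (l+1)-st of the letters that are still open after p, and for l = ht p a new letter.
mx  : Path → ℕ
lev : Path → ℕ → ℕ
mx []      = 0
mx (k ∷ p) = mx p ⊔ lev p k
lev []      l = 1
lev (k ∷ p) l with l ≤? k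
... | yes _ = lev p l
... | no  _ = suc (mx p ⊔ lev p k)

wordOf : Path → List ℕ
wordOf []      = []
wordOf (k ∷ p) = wordOf p ∷ʳ lev p k

lev-≤ : ∀ {k l} p → l ≤ k → lev (k ∷ p) l ≡ lev p l
lev-≤ {k} {l} p l≤k with l ≤? k
... | yes _   = refl
... | no  l≰k = contradiction l≤k l≰k

lev-> : ∀ {k l} p → k < l → lev (k ∷ p) l ≡ suc (mx (k ∷ p))
lev-> {k} {l} p k<l with l ≤? k
... | yes l≤k = contradiction l≤k (<⇒≱ k<l)
... | no  _   = refl

lev-ht : ∀ p → lev p (ht p) ≡ suc (mx p)
lev-ht []      = refl
lev-ht (k ∷ p) = lev-> p (n<1+n k)

mx-maxLetter : ∀ p → mx p ≡ maxLetter (wordOf p)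
mx-maxLetter []      = refl
mx-maxLetter (k ∷ p) = trans (cong₂ _⊔_ (mx-maxLetter p) (sym (⊔-identityʳ (lev p k)))) (sym (maxLetter-++ (wordOf p) _))

length-wordOf : ∀ p → length (wordOf p) ≡ length p
length-wordOf []      = refl
length-wordOf (k ∷ p) = trans (length-++ (wordOf p)) (trans (+-comm _ 1) (cong suc (length-wordOf p)))

1≤lev : ∀ p l → 1 ≤ lev p l
1≤lev []      l = s≤s z≤n
1≤lev (k ∷ p) l with l ≤? k
... | yes _ = 1≤lev p l
... | no  _ = s≤s z≤n

-- A step to `k` keeps the letters of the levels up to `k` and places the next new letter, one above
-- the maximum, on top of them. Hence a letter determines its level.
lev-mono-< : ∀ p → Valid p → ∀ {l l′} → l < l′ → l′ ≤ ht p → lev p l < lev p l′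
lev-mono-< []      _ {l} {l′} l<l′ l′≤0 = contradiction (≤-trans l<l′ l′≤0) λ ()
lev-mono-< (k ∷ p) (k≤ , vp) {l} {l′} l<l′ l′≤1+k with l′ ≤? k
... | yes l′≤k = subst (_< lev p l′) (sym (lev-≤ p (≤-trans (<⇒≤ l<l′) l′≤k))) (lev-mono-< p vp l<l′ (≤-trans l′≤k k≤))
... | no  l′≰k = s≤s (subst (_≤ mx p ⊔ lev p k) (sym (lev-≤ p l≤k)) (≤-trans (mono (m≤n⇒m<n∨m≡n l≤k)) (m≤n⊔m (mx p) (lev p k))))
  where
  l≤k : l ≤ k
  l≤k = s≤s⁻¹ (≤-trans l<l′ l′≤1+k)
  mono : l < k ⊎ l ≡ k → lev p l ≤ lev p k
  mono (inj₁ l<k)  = <⇒≤ (lev-mono-< p vp l<k k≤)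
  mono (inj₂ refl) = ≤-refl

lev≤1+mx : ∀ p → Valid p → ∀ {l} → l ≤ ht p → lev p l ≤ suc (mx p)
lev≤1+mx p vp l≤ with m≤n⇒m<n∨m≡n l≤
... | inj₁ l<   = ≤-trans (<⇒≤ (lev-mono-< p vp l< ≤-refl)) (≤-reflexive (lev-ht p))
... | inj₂ refl = ≤-reflexive (lev-ht p)

lev≤mx : ∀ p → Valid p → ∀ {l} → l < ht p → lev p l ≤ mx p
lev≤mx p vp l< = s≤s⁻¹ (≤-trans (lev-mono-< p vp l< ≤-refl) (≤-reflexive (lev-ht p)))

wordOf-RGW : ∀ p → Valid p → RGWFrom 0 (wordOf p)
wordOf-RGW []      _         = []
wordOf-RGW (k ∷ p) (k≤ , vp) = RGWFrom-++ 0 (wordOf-RGW p vp)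
  (cons (1≤lev p k) (≤-trans (lev≤1+mx p vp k≤) (≤-reflexive (cong suc (mx-maxLetter p)))) [])

⊆-∷ʳ⁻ : ∀ {A : Set} {x z : A} v {w} → v ∷ʳ z ⊆ w ∷ʳ x → v ∷ʳ z ⊆ w ⊎ (z ≡ x × v ⊆ w)
⊆-∷ʳ⁻ {x = x} {z} v {w} s with ⊆++⁻ w s
... | v₁ , .[] , eq , s₁ , (.x ∷ˢ []) = inj₁ (subst (_⊆ w) (trans (sym (++-identityʳ v₁)) (sym eq)) s₁)
... | v₁ , .(x ∷ []) , eq , s₁ , (refl ∷ []) with ∷ʳ-injective v v₁ eq
...   | refl , z≡x = inj₂ (z≡x , s₁)

-- The levels that a step to `k` keeps have letters at most the one it writes, and the letter of the
-- top level has not occurred yet.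
open-letter-minimal : ∀ p → Valid p → ∀ {l z} → l ≤ ht p → z < lev p l → ¬ (lev p l ∷ z ∷ [] ⊆ wordOf p)
open-letter-minimal (k ∷ p) (k≤ , vp) {l} {z} l≤ z< s with l ≤? k
... | yes l≤k with ⊆-∷ʳ⁻ (lev p l ∷ []) s
...   | inj₁ s′        = open-letter-minimal p vp (≤-trans l≤k k≤) z< s′
...   | inj₂ (refl , _) with m≤n⇒m<n∨m≡n l≤k
...     | inj₁ l<k  = contradiction (lev-mono-< p vp l<k k≤) (<-asym z<)
...     | inj₂ refl = contradiction z< (<-irrefl refl)
open-letter-minimal (k ∷ p) (k≤ , vp) {l} {z} l≤ z< s | no _ =
  contradiction (letter-≤max (∈-⊆ s (here refl))) (<⇒≱ (s≤s (≤-reflexive (sym (mx-maxLetter (k ∷ p))))))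

-- A letter is closed only by a step to a lower level, and that step writes a smaller letter after
-- it.
open-or-closed : ∀ p → Valid p → ∀ {y} → y ∈ wordOf p →
  (∃[ l ] (l < ht p × y ≡ lev p l)) ⊎ (∃[ z ] (z < y × y ∷ z ∷ [] ⊆ wordOf p))
open-or-closed (k ∷ p) (k≤ , vp) y∈ with ∈-++⁻ (wordOf p) y∈
... | inj₂ (here refl) = inj₁ (k , ≤-refl , sym (lev-≤ p ≤-refl))
... | inj₁ y∈p with open-or-closed p vp y∈p
...   | inj₂ (z , z<y , s) = inj₂ (z , z<y , ++⁺ʳ _ s)
...   | inj₁ (l , l< , refl) with l ≤? k
...     | yes l≤k = inj₁ (l , s≤s l≤k , sym (lev-≤ p l≤k))
...     | no  l≰k = inj₂ (lev p k , lev-mono-< p vp (≰⇒> l≰k) (<⇒≤ l<) , ++⁺ (from∈ y∈p) ⊆-refl)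

wordOf-noncrossing : ∀ p → Valid p → ¬ Crossing (wordOf p)
wordOf-noncrossing []      _         (a , b , a<b , ())
wordOf-noncrossing (k ∷ p) (k≤ , vp) (a , b , a<b , s) with ⊆-∷ʳ⁻ (a ∷ b ∷ a ∷ []) s
... | inj₁ s′          = wordOf-noncrossing p vp (a , b , a<b , s′)
-- The final `b` is the letter of level `k`, yet the smaller `a` follows its earlier occurrence.
... | inj₂ (refl , s′) = open-letter-minimal p vp k≤ a<b (∷ˡ⁻ s′)

-- The last letter is new and gets the top level, or is open and gets its own level, or is closed
-- and would complete a crossing.
noncrossing⇒path : ∀ {w} → RGWFrom 0 w → ¬ Crossing w → ∃[ p ] (Valid p × wordOf p ≡ w)
noncrossing⇒path {w} = go (reverseView w)
  where
  go : ∀ {w} → Reverse w → RGWFrom 0 w → ¬ Crossing w → ∃[ p ] (Valid p × wordOf p ≡ w)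
  go []            g nc = [] , tt , refl
  go (w ∶ rs ∶ʳ x) g nc with RGWFrom-++⁻ w g
  ... | gw , cons 1≤x x≤ [] with go rs gw (λ (a , b , a<b , s) → nc (a , b , a<b , ++⁺ʳ _ s))
  ...   | p , vp , refl with m≤n⇒m<n∨m≡n x≤
  ...     | inj₂ refl = ht p ∷ p , (≤-refl , vp) ,
                        cong (λ z → wordOf p ∷ʳ z) (trans (lev-ht p) (cong suc (mx-maxLetter p)))
  ...     | inj₁ x<   with open-or-closed p vp (from (letters gw x) (1≤x , s≤s⁻¹ x<))
  ...       | inj₁ (l , l< , refl)  = l ∷ p , (<⇒≤ l< , vp) , refl
  -- z also occurs before the walksUntil x, so z x z x is a crossing
  ...       | inj₂ (z , z<x , s) with ++⊆⁻ (x ∷ []) s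
  ...         | w₁ , w₂ , w≡ , x⊆ , z⊆ with ∈-∃++ (to∈ x⊆)
  ...           | u , v , refl = contradiction (z , x , z<x , zxzx) nc
    where
    w≡′ : wordOf p ≡ u ++ x ∷ (v ++ w₂)
    w≡′ = trans w≡ (++-assoc u (x ∷ v) w₂)
    z∈u : z ∈ u
    z∈u = RGW-smaller u (subst (RGWFrom 0) w≡′ gw) (letter-≥1 gw (∈-⊆ s (there (here refl)))) z<x
    zxzx : z ∷ x ∷ z ∷ x ∷ [] ⊆ wordOf p ∷ʳ x
    zxzx = ++⁺ (subst (z ∷ x ∷ z ∷ [] ⊆_) (sym w≡′) (++⁺ (from∈ z∈u) (refl ∷ ++⁺ˡ v z⊆))) ⊆-refl

wordOf-injective : ∀ p q → Valid p → Valid q → wordOf p ≡ wordOf q → p ≡ q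
wordOf-injective []      []      _ _ _ = refl
wordOf-injective []      (l ∷ q) _ _ eq = contradiction (trans (cong length eq) (length-wordOf (l ∷ q))) λ ()
wordOf-injective (k ∷ p) []      _ _ eq = contradiction (trans (cong length (sym eq)) (length-wordOf (k ∷ p))) λ ()
wordOf-injective (k ∷ p) (l ∷ q) (k≤ , vp) (l≤ , vq) eq
  with wordOf-injective p q vp vq (proj₁ (∷ʳ-injective (wordOf p) (wordOf q) eq))
... | refl with <-cmp k l
...   | tri≈ _ refl _ = refl
...   | tri< k<l _ _ = contradiction (proj₂ (∷ʳ-injective (wordOf p) (wordOf q) eq)) (<⇒≢ (lev-mono-< p vp k<l l≤))
...   | tri> _ _ l<k = contradiction (sym (proj₂ (∷ʳ-injective (wordOf p) (wordOf q) eq))) (<⇒≢ (lev-mono-< p vp l<k k≤))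

-- Partitions containing a concatenation

module Above (u : Path) (valid-u : Valid u) where

  m : ℕ
  m = maxLetter (wordOf u)

  -- The invariant that links a path `q` above `u` to the insertion state `(i , c , k , W)`. The
  -- lowest `i` levels of `q` are those of `u`; the next `k` are the levels of `W` from the cut `c`
  -- on, shifted by `m`, and the topmost of them is the next new letter.
  record Describes (i c k : ℕ) (W q : Path) : Set where
    field
      ht-q    : suc (ht q) ≡ i + k
      ht-W    : suc (ht W) ≡ c + k
      i≤ht-u  : i ≤ ht u
      valid-q : Valid q
      valid-W : Valid W
      mx-q    : mx q ≡ m + mx W
      old     : ∀ l → l < i → lev q l ≡ lev u l
      new     : ∀ l → l < k → lev q (i + l) ≡ m + lev W (c + l)
      rest    : List ℕ
      word-q  : wordOf q ≡ wordOf u ++ rest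
      word-W  : map (m +_) (wordOf W) ≡ filter (m <?_) rest

  open Describes

  start : Describes (ht u) 0 1 [] u
  start = record
    { ht-q = +-comm 1 (ht u) ; ht-W = refl ; i≤ht-u = ≤-refl ; valid-q = valid-u ; valid-W = tt
    ; mx-q = trans (mx-maxLetter u) (sym (+-identityʳ m))
    ; old = λ _ _ → refl
    ; new = λ { zero _ → trans (cong (lev u) (+-identityʳ (ht u)))
                  (trans (lev-ht u) (trans (cong suc (mx-maxLetter u)) (+-comm 1 m)))
              ; (suc l) (s≤s ()) }
    ; rest = [] ; word-q = sym (++-identityʳ (wordOf u)) ; word-W = refl
    }

  -- The repetition closes every open letter of `W`, so the only level left above `j` is that of the
  -- next new letter.
  step-old : ∀ {i c k W q} → Describes i c k W q → ∀ j → j < i →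
             Describes (suc j) (ht W) 1 W (j ∷ q)
  step-old {i} {c} {k} {W} {q} d j j<i = record
    { ht-q = cong suc (+-comm 1 j) ; ht-W = +-comm 1 (ht W)
    ; i≤ht-u = ≤-trans j<i (i≤ht-u d)
    ; valid-q = s≤s⁻¹ (≤-trans (≤-trans j<i (m≤m+n i k)) (≤-reflexive (sym (ht-q d)))) , valid-q d
    ; valid-W = valid-W d
    ; mx-q = mx-q′
    ; old = λ l l<1+j → trans (lev-≤ q (s≤s⁻¹ l<1+j)) (old d l (≤-trans l<1+j j<i))
    ; new = λ { zero _ → begin
                  lev (j ∷ q) (suc j + 0)  ≡⟨ lev-> q (s≤s (m≤m+n j 0)) ⟩
                  suc (mx (j ∷ q))         ≡⟨ cong suc mx-q′ ⟩
                  suc (m + mx W)           ≡⟨ +-suc m (mx W) ⟨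
                  m + suc (mx W)           ≡⟨ cong (m +_) (trans (cong (lev W) (+-identityʳ (ht W))) (lev-ht W)) ⟨
                  m + lev W (ht W + 0)     ∎
              ; (suc l) (s≤s ()) }
    ; rest = rest d ∷ʳ lev q j
    ; word-q = trans (cong (_∷ʳ lev q j) (word-q d)) (++-assoc (wordOf u) (rest d) _)
    ; word-W = begin
        map (m +_) (wordOf W)                                   ≡⟨ word-W d ⟩
        filter (m <?_) (rest d)                                 ≡⟨ ++-identityʳ _ ⟨
        filter (m <?_) (rest d) ++ []                           ≡⟨ cong (filter (m <?_) (rest d) ++_) (filter-reject (m <?_) (≤⇒≯ lev≤m)) ⟨
        filter (m <?_) (rest d) ++ filter (m <?_) (lev q j ∷ []) ≡⟨ filter-++ (m <?_) (rest d) _ ⟨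
        filter (m <?_) (rest d ∷ʳ lev q j)                      ∎
    }
    where
    open ≡-Reasoning
    lev≤m : lev q j ≤ m
    lev≤m = subst₂ _≤_ (sym (old d j j<i)) (mx-maxLetter u) (lev≤mx u valid-u (≤-trans j<i (i≤ht-u d)))
    mx-q′ : mx q ⊔ lev q j ≡ m + mx W
    mx-q′ = trans (m≥n⇒m⊔n≡m (≤-trans lev≤m (≤-trans (m≤m+n m (mx W)) (≤-reflexive (sym (mx-q d)))))) (mx-q d)

  step-new : ∀ {i c k W q} → Describes i c k W q → ∀ r → r < k →
             Describes i c (suc (suc r)) ((c + r) ∷ W) ((i + r) ∷ q)
  step-new {i} {c} {k} {W} {q} d r r<k = record
    { ht-q = +-2+ i ; ht-W = +-2+ c
    ; i≤ht-u = i≤ht-u d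
    ; valid-q = s≤s⁻¹ (≤-trans (+-monoʳ-< i r<k) (≤-reflexive (sym (ht-q d)))) , valid-q d
    ; valid-W = s≤s⁻¹ (≤-trans (+-monoʳ-< c r<k) (≤-reflexive (sym (ht-W d)))) , valid-W d
    ; mx-q = mx-q′
    ; old = λ l l<i → trans (lev-≤ q (≤-trans (<⇒≤ l<i) (m≤m+n i r))) (old d l l<i)
    ; new = new′
    ; rest = rest d ∷ʳ lev q (i + r)
    ; word-q = trans (cong (_∷ʳ lev q (i + r)) (word-q d)) (++-assoc (wordOf u) (rest d) _)
    ; word-W = begin
        map (m +_) (wordOf W ∷ʳ lev W (c + r))          ≡⟨ map-++ (m +_) (wordOf W) _ ⟩
        map (m +_) (wordOf W) ∷ʳ (m + lev W (c + r))    ≡⟨ cong₂ _∷ʳ_ (word-W d) (sym (new d r r<k)) ⟩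
        filter (m <?_) (rest d) ∷ʳ lev q (i + r)        ≡⟨ cong (filter (m <?_) (rest d) ++_) (filter-accept (m <?_) m<lev) ⟨
        filter (m <?_) (rest d) ++ filter (m <?_) (lev q (i + r) ∷ []) ≡⟨ filter-++ (m <?_) (rest d) _ ⟨
        filter (m <?_) (rest d ∷ʳ lev q (i + r))        ∎
    }
    where
    open ≡-Reasoning
    +-2+ : ∀ x → suc (suc (x + r)) ≡ x + suc (suc r)
    +-2+ x = sym (trans (+-suc x (suc r)) (cong suc (+-suc x r)))
    m<lev : m < lev q (i + r)
    m<lev = subst (m <_) (sym (new d r r<k)) (m<m+n m (1≤lev W (c + r)))
    mx-q′ : mx q ⊔ lev q (i + r) ≡ m + (mx W ⊔ lev W (c + r))
    mx-q′ = trans (cong₂ _⊔_ (mx-q d) (new d r r<k)) (sym (+-distribˡ-⊔ m (mx W) (lev W (c + r))))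
    new′ : ∀ l → l < suc (suc r) → lev ((i + r) ∷ q) (i + l) ≡ m + lev ((c + r) ∷ W) (c + l)
    new′ l l<2+r with m≤n⇒m<n∨m≡n (s≤s⁻¹ l<2+r)
    ... | inj₁ l<1+r = begin
      lev ((i + r) ∷ q) (i + l)        ≡⟨ lev-≤ q (+-monoʳ-≤ i (s≤s⁻¹ l<1+r)) ⟩
      lev q (i + l)                    ≡⟨ new d l (≤-trans l<1+r r<k) ⟩
      m + lev W (c + l)                ≡⟨ cong (m +_) (lev-≤ W (+-monoʳ-≤ c (s≤s⁻¹ l<1+r))) ⟨
      m + lev ((c + r) ∷ W) (c + l)    ∎
    ... | inj₂ refl = begin
      lev ((i + r) ∷ q) (i + suc r)    ≡⟨ lev-> q (+-monoʳ-< i (n<1+n r)) ⟩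
      suc (mx ((i + r) ∷ q))           ≡⟨ cong suc mx-q′ ⟩
      suc (m + mx ((c + r) ∷ W))       ≡⟨ +-suc m _ ⟨
      m + suc (mx ((c + r) ∷ W))       ≡⟨ cong (m +_) (lev-> W (+-monoʳ-< c (n<1+n r))) ⟨
      m + lev ((c + r) ∷ W) (c + suc r) ∎

occurs : List ℕ → Path → Bool
occurs s p = does (wordOf p ⊒? s)

-- The weight is taken at the number of components plus one, which makes merge symmetric.
containing : List ℕ → (ℕ → ℕ → ℕ) → ℕ → ℕ
containing s φ = λ n → walks (λ n p → if occurs s p then φ n (suc (ht p)) else 0) n []

containing-cong : ∀ s {φ χ} → (∀ n a → φ n a ≡ χ n a) → ∀ n → containing s φ n ≡ containing s χ n
containing-cong s {φ} {χ} h n = walks-cong n (λ n p _ → by-cases (occurs s p) n (suc (ht p))) []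
  where
  by-cases : ∀ b n a → (if b then φ n a else 0) ≡ (if b then χ n a else 0)
  by-cases true  n a = h n a
  by-cases false n a = refl

infixr 5 _⊕_
_⊕_ : List ℕ → List ℕ → List ℕ
α ⊕ β = α ++ map (maxLetter α +_) β

module _ (α β : List ℕ) (gβ : RGWFrom 0 β) (φ : ℕ → ℕ → ℕ) where

  private
    Φ : Weight Path
    Φ n q = if occurs (α ⊕ β) q then φ n (suc (ht q)) else 0

    Ψ : Weight Insertion
    Ψ n (i , c , k , W) = if occurs β W then φ n (i + k) else 0

  module _ (u : Path) (valid-u : Valid u) (u⊒α : wordOf u ⊒ α) (minimal : Minimal α (wordOf u)) where
    open Above u valid-u
    open Describes

    weights-agree : ∀ {i c k W q} → Describes i c k W q → ∀ n → Φ n q ≡ Ψ n (i , c , k , W)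
    weights-agree {i} {c} {k} {W} {q} d n = cong₂ (λ b a → if b then φ n a else 0)
      (does-⇔ (mk⇔
          (λ q⊒ → concat-⊒⁻ {α} {rest = rest d} gβ (subst (RGWFrom 0) (word-q d) (wordOf-RGW q (valid-q d)))
             (subst (λ w → ¬ Crossing w) (word-q d) (wordOf-noncrossing q (valid-q d)))
             (word-W d) u⊒α minimal (subst (_⊒ (α ⊕ β)) (word-q d) q⊒))
          (λ W⊒ → subst (_⊒ (α ⊕ β)) (sym (word-q d))
             (concat-⊒⁺ {α} {W = wordOf W} gβ (wordOf-RGW W (valid-W d)) (word-W d) u⊒α W⊒)))
        (wordOf q ⊒? (α ⊕ β)) (wordOf W ⊒? β))
      (ht-q d)

    walks-describes : ∀ n {i c k W q} → Describes i c k W q → walks Φ n q ≡ Ins.walks Ψ n (i , c , k , W)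
    walks-describes zero    d = weights-agree d 0
    walks-describes (suc n) {i} {c} {k} {W} {q} d = cong₂ _+_ (weights-agree d (suc n)) (begin
      Σ< (suc (ht q)) (λ l → walks Φ n (l ∷ q))
        ≡⟨ cong (λ h → Σ< h (λ l → walks Φ n (l ∷ q))) (ht-q d) ⟩
      Σ< (i + k) (λ l → walks Φ n (l ∷ q))
        ≡⟨ Σ<-split i k _ ⟩
      Σ< i (λ j → walks Φ n (j ∷ q)) + Σ< k (λ r → walks Φ n ((i + r) ∷ q))
        ≡⟨ cong₂ _+_ (Σ<-cong-< i λ j j<i → walks-describes n (step-old d j j<i))
                     (Σ<-cong-< k λ r r<k → walks-describes n (step-new d r r<k)) ⟩
      Σ< i (λ j → Ins.walks Ψ n (suc j , ht W , 1 , W)) +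
      Σ< k (λ r → Ins.walks Ψ n (i , c , suc (suc r) , (c + r) ∷ W)) ∎)
      where open ≡-Reasoning

    -- By `walks-insertion` one may sum over `W` first and over the chains afterwards. Whether `β`
    -- occurs depends on `W` alone, so the test leaves the chain sum, and what remains is a `merge`.
    walks-above : ∀ n → walks Φ n u ≡ containing β (λ n b → merge φ n (ht u) b) n
    walks-above n = begin
      walks Φ n u
        ≡⟨ walks-describes n start ⟩
      Ins.walks Ψ n (ht u , 0 , 1 , [])
        ≡⟨ walks-insertion (ht u) Ψ n ⟨
      walks (λ n W → chains (λ n i q k → Ψ n (i , q , k , W)) n (ht u) 0 (suc (ht W))) n []
        ≡⟨ walks-cong n (λ n W _ → by-cases (occurs β W) n (suc (ht W))) [] ⟩
      containing β (λ n b → merge φ n (ht u) b) n ∎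
      where
      open ≡-Reasoning
      by-cases : ∀ b n a → chains (λ n i q k → if b then φ n (i + k) else 0) n (ht u) 0 a ≡
                           (if b then merge φ n (ht u) a else 0)
      by-cases true  n a = chains-merge φ n (ht u) 0 a
      by-cases false n a = chains-0 n (ht u) 0 a

  -- Cut at the shortest prefix that contains α.
  containing-⊕ : ∀ n → containing (α ⊕ β) φ n ≡
    walksUntil (occurs α) (λ n u → containing β (λ n b → merge φ n (ht u) b) n) n []
  containing-⊕ n = trans (walks-walksUntil (occurs α) Φ vanish n []) (go n [] tt empty)
    where
    -- A word that contains `α ⊕ β` contains `α`, so there is no weight before the first passage.
    vanish : ∀ n p → occurs α p ≡ false → Φ n p ≡ 0
    vanish n p eq with wordOf p ⊒? (α ⊕ β)
    ... | no  _ = refl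
    ... | yes (v , v⊆ , o) with OrderIsomorphic-++⁻ v α (map (maxLetter α +_) β) o (≺-concat {α} gβ)
    ...   | E , F , refl , oE , _ = contradiction
            (trans (sym (dec-true (wordOf p ⊒? α) (E , ⊆-trans (++⁺ʳ F ⊆-refl) v⊆ , oE))) eq) λ ()
    ψ : Weight Path
    ψ n u = containing β (λ n b → merge φ n (ht u) b) n
    go : ∀ n p → Valid p → Minimal α (wordOf p) →
         walksUntil (occurs α) (walks Φ) n p ≡ walksUntil (occurs α) ψ n p
    go zero    p vp min with wordOf p ⊒? α
    ... | yes p⊒α = walks-above p vp p⊒α min 0
    ... | no  _   = refl
    go (suc n) p vp min with wordOf p ⊒? α
    ... | yes p⊒α = walks-above p vp p⊒α min (suc n)
    ... | no  p⋣α = Σ<-cong-< (suc (ht p)) λ k k< → go n (k ∷ p) (s≤s⁻¹ k< , vp) (snoc (lev p k) p⋣α)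

-- Two uses of `containing-⊕` give independent first-passage sums over `u` and `v`, which commute.
-- The inner weight is the product of `ht u`, `ht v` and a level from `γ`, symmetric in the first
-- two because `merge` is associative and commutative.
containing-swap : ∀ α β γ → RGWFrom 0 α → RGWFrom 0 β → RGWFrom 0 γ → ∀ φ n →
  containing (α ⊕ β ⊕ γ) φ n ≡ containing (β ⊕ α ⊕ γ) φ n
containing-swap α β γ gα gβ gγ φ n = begin
  containing (α ⊕ β ⊕ γ) φ n
    ≡⟨ expand α β gβ n ⟩
  walksUntil (occurs α) (λ n u → walksUntil (occurs β) (λ n v → C (ht u) (ht v) n) n []) n []
    ≡⟨ walksUntil-comm (occurs α) (occurs β) (λ u n v → C (ht u) (ht v) n) n [] [] ⟩
  walksUntil (occurs β) (λ n v → walksUntil (occurs α) (λ n u → C (ht u) (ht v) n) n []) n []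
    ≡⟨ walksUntil-cong (occurs β) (λ n v → walksUntil-cong (occurs α) (λ n u → C-sym (ht u) (ht v) n) n []) n [] ⟩
  walksUntil (occurs β) (λ n v → walksUntil (occurs α) (λ n u → C (ht v) (ht u) n) n []) n []
    ≡⟨ expand β α gα n ⟨
  containing (β ⊕ α ⊕ γ) φ n ∎
  where
  open ≡-Reasoning
  C : ℕ → ℕ → ℕ → ℕ
  C d e = containing γ (λ n c → merge (λ n f → merge φ n d f) n e c)
  C-sym : ∀ d e n → C d e n ≡ C e d n
  C-sym d e = containing-cong γ λ n c → begin
    merge (λ n f → merge φ n d f) n e c ≡⟨ merge-assoc φ n d e c ⟨
    merge (λ n f → merge φ n f c) n d e ≡⟨ merge-comm (λ n f → merge φ n f c) n d e ⟩
    merge (λ n f → merge φ n f c) n e d ≡⟨ merge-assoc φ n e d c ⟩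
    merge (λ n f → merge φ n e f) n d c ∎
  expand : ∀ α β → RGWFrom 0 β → ∀ n → containing (α ⊕ β ⊕ γ) φ n ≡
    walksUntil (occurs α) (λ n u → walksUntil (occurs β) (λ n v → C (ht u) (ht v) n) n []) n []
  expand α β gβ n = trans (containing-⊕ α (β ⊕ γ) (RGWFrom-concat β gβ gγ) φ n)
    (walksUntil-cong (occurs α) (λ n u → containing-⊕ β γ gγ (λ n b → merge φ n (ht u) b) n) n [])

-- Components

RGWFrom? : ∀ m w → Dec (RGWFrom m w)
RGWFrom? m []      = yes []
RGWFrom? m (x ∷ w) = map′ (λ (a , b , g) → cons a b g) (λ { (cons a b g) → a , b , g })
  ((1 ≤? x) ×-dec (x ≤? suc m) ×-dec RGWFrom? (m ⊔ x) w)

-- The stored proof is irrelevant, but decidability of `RGWFrom` lets it be recomputed.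
word-RGW : ∀ π → RGWFrom 0 (word π)
word-RGW (w , irr g) = recompute (RGWFrom? 0 w) g

maxLetter-⊕ : ∀ α β → maxLetter (α ⊕ β) ≡ maxLetter α + maxLetter β
maxLetter-⊕ α β = trans (maxLetter-++ α _) (shift (maxLetter α) β)
  where
  shift : ∀ r β → r ⊔ maxLetter (map (r +_) β) ≡ r + maxLetter β
  shift r []      = trans (⊔-identityʳ r) (sym (+-identityʳ r))
  shift r (x ∷ β) = begin
    r ⊔ ((r + x) ⊔ maxLetter (map (r +_) β))   ≡⟨ ⊔-assoc r (r + x) _ ⟨
    (r ⊔ (r + x)) ⊔ maxLetter (map (r +_) β)   ≡⟨ cong (_⊔ maxLetter (map (r +_) β)) (⊔-comm r (r + x)) ⟩
    ((r + x) ⊔ r) ⊔ maxLetter (map (r +_) β)   ≡⟨ ⊔-assoc (r + x) r _ ⟩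
    (r + x) ⊔ (r ⊔ maxLetter (map (r +_) β))   ≡⟨ cong ((r + x) ⊔_) (shift r β) ⟩
    (r + x) ⊔ (r + maxLetter β)                ≡⟨ +-distribˡ-⊔ r x (maxLetter β) ⟨
    r + (x ⊔ maxLetter β)                      ∎
    where open ≡-Reasoning

⊕-assoc : ∀ α β γ → (α ⊕ β) ⊕ γ ≡ α ⊕ (β ⊕ γ)
⊕-assoc α β γ = trans (++-assoc α _ _) (cong (α ++_) (trans
  (cong (map (maxLetter α +_) β ++_) (trans
    (map-cong (λ x → trans (cong (_+ x) (maxLetter-⊕ α β)) (+-assoc (maxLetter α) (maxLetter β) x)) γ)
    (map-∘ γ)))
  (sym (map-++ (maxLetter α +_) β (map (maxLetter β +_) γ)))))

bracket-++ : ∀ σs τs → word (bracket (σs ++ τs)) ≡ word (bracket σs) ⊕ word (bracket τs)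
bracket-++ []       τs = sym (trans (map-cong (λ _ → refl) _) (map-id _))
bracket-++ (σ ∷ σs) τs = trans (cong (word σ ⊕_) (bracket-++ σs τs)) (sym (⊕-assoc (word σ) _ _))

-- If a crossing were divided between the two parts, one of its letters would occur in both,
-- although all letters of the first part are smaller than those of the second.
noncrossing-⊕ : ∀ {α β} → RGWFrom 0 β → ¬ Crossing α → ¬ Crossing β → ¬ Crossing (α ⊕ β)
noncrossing-⊕ {α} {β} gβ ncα ncβ (a , b , a<b , s) with ⊆++⁻ α s
... | [] , _ , refl , _ , s₂ with ⊆map⁻ (maxLetter α +_) β s₂
...   | x ∷ y ∷ x′ ∷ y′ ∷ [] , eq , s₃ = ncβ (x , y , +-cancelˡ-< (maxLetter α) x y (subst₂ _<_ (at 0 eq) (at 1 eq) a<b) ,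
          subst₂ (λ z w → x ∷ y ∷ z ∷ w ∷ [] ⊆ β) (sym (+-cancelˡ-≡ (maxLetter α) x x′ (trans (sym (at 0 eq)) (at 2 eq))))
            (sym (+-cancelˡ-≡ (maxLetter α) y y′ (trans (sym (at 1 eq)) (at 3 eq)))) s₃)
  where
  nth : ℕ → List ℕ → ℕ
  nth n       []      = 0
  nth zero    (x ∷ _) = x
  nth (suc n) (_ ∷ w) = nth n w
  at : ∀ n {v w} → v ≡ w → nth n v ≡ nth n w
  at n = cong (nth n)
noncrossing-⊕ {α} {β} gβ ncα ncβ (a , b , a<b , s) | _ ∷ [] , _ , refl , s₁ , s₂ =
  <-irrefl refl (≺-concat {α} gβ (∈-⊆ s₁ (here refl)) (∈-⊆ s₂ (there (here refl))))
noncrossing-⊕ {α} {β} gβ ncα ncβ (a , b , a<b , s) | _ ∷ _ ∷ [] , _ , refl , s₁ , s₂ =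
  <-irrefl refl (≺-concat {α} gβ (∈-⊆ s₁ (here refl)) (∈-⊆ s₂ (here refl)))
noncrossing-⊕ {α} {β} gβ ncα ncβ (a , b , a<b , s) | _ ∷ _ ∷ _ ∷ [] , _ , refl , s₁ , s₂ =
  <-irrefl refl (≺-concat {α} gβ (∈-⊆ s₁ (there (here refl))) (∈-⊆ s₂ (here refl)))
noncrossing-⊕ {α} {β} gβ ncα ncβ (a , b , a<b , s) | _ ∷ _ ∷ _ ∷ _ ∷ [] , _ , refl , s₁ , s₂ =
  ncα (a , b , a<b , s₁)
noncrossing-⊕ {α} {β} gβ ncα ncβ (a , b , a<b , s) | _ ∷ _ ∷ _ ∷ _ ∷ _ ∷ _ , _ , () , s₁ , s₂

bracket-noncrossing : ∀ {σs} → All NonCrossing σs → NonCrossing (bracket σs)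
bracket-noncrossing {σs} ncs c = go σs ncs (1212⇒crossing c)
  where
  go : ∀ σs → All NonCrossing σs → ¬ Crossing (word (bracket σs))
  go []       []         (_ , _ , _ , ())
  go (σ ∷ σs) (nc ∷ ncs) =
    noncrossing-⊕ {word σ} (word-RGW (bracket σs)) (λ c → nc (crossing⇒1212 c)) (go σs ncs)

nonempty-word : ∀ {π} → NonEmpty π → word π ≢ []
nonempty-word ne w≡[] = ne (value-injective w≡[])

-- A nonempty `z` would be the shift of a prefix `A′` of `A`, itself a restricted growth word, and
-- would split `τ` as `σ` followed by `A′`.
prefix-components : ∀ σ τ z A B → Connected τ → NonEmpty σ → RGWFrom 0 A →
  word τ ≡ word σ ++ z → map (blocks σ +_) A ≡ z ++ B → z ≡ []
prefix-components σ τ []      A B con ne gA τ≡ A≡ = refl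
prefix-components σ τ (x ∷ z) A B con ne gA τ≡ A≡ with map-++⁻ (blocks σ +_) A (x ∷ z) A≡
... | A′ , A″ , refl , z≡ , _ = contradiction
  (σ , (A′ , irr (proj₁ (RGWFrom-++⁻ A′ gA))) , ne , (λ eq → nonempty A′ (cong value eq) z≡) ,
   value-injective (trans τ≡ (cong (word σ ++_) (sym z≡))))
  con
  where
  nonempty : ∀ A′ → A′ ≡ [] → map (blocks σ +_) A′ ≢ x ∷ z
  nonempty [] refl ()

-- One of the two first components is a prefix of the other; by `prefix-components` they are equal
-- and can be cancelled.
components-length : ∀ σs τs → All NonEmpty σs → All Connected σs → All NonEmpty τs → All Connected τs →
  word (bracket σs) ≡ word (bracket τs) → length σs ≡ length τs
components-length []       []       _ _ _ _ _ = refl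
components-length []       (τ ∷ τs) _ _ (ne ∷ _) _ eq =
  contradiction (++-conicalˡ (word τ) _ (sym eq)) (nonempty-word ne)
components-length (σ ∷ σs) []       (ne ∷ _) _ _ _ eq =
  contradiction (++-conicalˡ (word σ) _ eq) (nonempty-word ne)
components-length (σ ∷ σs) (τ ∷ τs) (neσ ∷ neσs) (cσ ∷ cσs) (neτ ∷ neτs) (cτ ∷ cτs) eq = cong suc
  (components-length σs τs neσs cσs neτs cτs (rest≡ (split (++-split (word σ) (word τ) eq))))
  where
  A B : List ℕ
  A = word (bracket σs)
  B = word (bracket τs)
  split : (∃[ z ] word σ ≡ word τ ++ z) ⊎
          (∃[ x ] ∃[ z ] (word τ ≡ word σ ++ x ∷ z × map (blocks σ +_) A ≡ x ∷ z ++ map (blocks τ +_) B)) →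
          word σ ≡ word τ
  split (inj₁ (z , σ≡)) with prefix-components τ σ z B (map (blocks σ +_) A) cσ neτ (word-RGW (bracket τs)) σ≡
    (++-cancelˡ (word τ) _ _ (trans (sym eq) (trans (cong (_++ map (blocks σ +_) A) σ≡) (++-assoc (word τ) z _))))
  ... | refl = trans σ≡ (++-identityʳ (word τ))
  split (inj₂ (x , z , τ≡ , A≡)) with prefix-components σ τ (x ∷ z) A (map (blocks τ +_) B) cτ neσ (word-RGW (bracket σs)) τ≡ A≡
  ... | ()
  rest≡ : word σ ≡ word τ → A ≡ B
  rest≡ σ≡τ = map-injective (+-cancelˡ-≡ (blocks σ) _ _)
    (++-cancelˡ (word σ) _ _ (trans eq (cong (_⊕ B) (sym σ≡τ))))

components-unique : ∀ {π m n} → NumberOfComponents π m → NumberOfComponents π n → m ≡ n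
components-unique (σs , (neσ , cσ , eqσ) , refl) (τs , (neτ , cτ , eqτ) , refl) =
  components-length σs τs neσ cσ neτ cτ (cong value (trans (sym eqσ) eqτ))

partition : ∀ p → Valid p → Partition
partition p vp = wordOf p , irr (wordOf-RGW p vp)

-- A final letter 1 joins all components into one; on `∅` it creates a component with one letter.
append-one : Partition → Partition
append-one π = (word π ∷ʳ 1) , irr (RGWFrom-++ 0 (word-RGW π) (cons ≤-refl (s≤s z≤n) []))

append-one-nonempty : ∀ π → NonEmpty (append-one π)
append-one-nonempty π eq with word π | cong value eq
... | []    | ()
... | _ ∷ _ | ()

-- In a nontrivial splitting the last letter belongs to the second part and is at least 2.
append-one-connected : ∀ π → Connected (append-one π)
append-one-connected π (α , β , neα , neβ , eq) with word β | word-RGW β | reverseView (word β) | nonempty-word neβ | cong value eq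
... | .[]        | _  | []           | ne | _  = ne refl
... | .(v ∷ʳ z)  | gβ | v ∶ _ ∶ʳ z   | _  | e = <-irrefl 1≡ (+-mono-≤ (1≤blocks (word α) (word-RGW α) (nonempty-word neα)) (letter-≥1 gβ (∈-++⁺ʳ v (here refl))))
  where
  1≡ : 1 ≡ blocks α + z
  1≡ = ∷ʳ-injectiveʳ (word π) (word α ++ map (blocks α +_) v)
    (trans e (trans (cong (word α ++_) (map-++ (blocks α +_) v (z ∷ []))) (sym (++-assoc (word α) _ _))))
  1≤blocks : ∀ w → RGWFrom 0 w → w ≢ [] → 1 ≤ maxLetter w
  1≤blocks []      g ne = contradiction refl ne
  1≤blocks (x ∷ w) g ne = ≤-trans (letter-≥1 g (here refl)) (m≤m⊔n x (maxLetter w))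

-- The letter written by a return to level l starts the (l+1)-st component.
partition-components : ∀ p (vp : Valid p) → ∃[ σs ]
  (Components (partition p vp) σs × length σs ≡ ht p ×
   (∀ l → l ≤ ht p → lev p l ≡ suc (blocks (bracket (take l σs)))))
partition-components []      _         = [] , ([] , [] , refl) , refl , λ { zero _ → refl }
partition-components (k ∷ p) (k≤ , vp) with partition-components p vp
... | σs , (ne , con , eq) , len , levs =
  σs′ , (All.++⁺ (All.take⁺ k ne) (append-one-nonempty γ ∷ []) , All.++⁺ (All.take⁺ k con) (append-one-connected γ ∷ []) ,
         value-injective word≡) , len′ , levs′
  where
  open ≡-Reasoning
  γ : Partition
  γ = bracket (drop k σs)
  -- The first `k` components survive, and the others are joined by the new letter. For `k = ht p`
  -- there are no others, and the letter is a component of its own.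
  σs′ : List Partition
  σs′ = take k σs ∷ʳ append-one γ
  a : List ℕ
  a = word (bracket (take k σs))
  len-take : length (take k σs) ≡ k
  len-take = trans (length-take k σs) (m≤n⇒m⊓n≡m (≤-trans k≤ (≤-reflexive (sym len))))
  len′ : length σs′ ≡ suc k
  len′ = trans (length-++ (take k σs)) (trans (+-comm _ 1) (cong suc len-take))
  word≡ : wordOf (k ∷ p) ≡ word (bracket σs′)
  word≡ = begin
    wordOf p ∷ʳ lev p k
      ≡⟨ cong₂ _∷ʳ_ (trans (cong value eq) (trans (cong (λ τs → word (bracket τs)) (sym (take++drop≡id k σs))) (bracket-++ (take k σs) (drop k σs)))) (levs k k≤) ⟩
    (a ⊕ word γ) ∷ʳ suc (maxLetter a)
      ≡⟨ ++-assoc a _ _ ⟩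
    a ++ (map (maxLetter a +_) (word γ) ∷ʳ suc (maxLetter a))
      ≡⟨ cong (λ x → a ++ (map (maxLetter a +_) (word γ) ∷ʳ x)) (+-comm 1 (maxLetter a)) ⟩
    a ++ (map (maxLetter a +_) (word γ) ∷ʳ (maxLetter a + 1))
      ≡⟨ cong (a ++_) (map-++ (maxLetter a +_) (word γ) (1 ∷ [])) ⟨
    a ⊕ word (append-one γ)
      ≡⟨ cong (a ⊕_) (⊕-[] (word (append-one γ))) ⟨
    a ⊕ word (bracket (append-one γ ∷ []))
      ≡⟨ bracket-++ (take k σs) (append-one γ ∷ []) ⟨
    word (bracket σs′) ∎
    where
    ⊕-[] : ∀ w → w ⊕ [] ≡ w
    ⊕-[] w = ++-identityʳ w
  levs′ : ∀ l → l ≤ suc k → lev (k ∷ p) l ≡ suc (blocks (bracket (take l σs′)))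
  levs′ l l≤1+k with l ≤? k
  ... | yes l≤k = trans (levs l (≤-trans l≤k k≤)) (cong (λ τs → suc (blocks (bracket τs))) (sym (take-prefix σs l≤k (≤-trans k≤ (≤-reflexive (sym len))))))
    where
    take-prefix : ∀ σs {l k τs} → l ≤ k → k ≤ length σs → take l (take k σs ++ τs) ≡ take l σs
    take-prefix σs       {zero}  {k}     _         _         = refl
    take-prefix (σ ∷ σs) {suc l} {suc k} (s≤s l≤k) (s≤s k≤) = cong (σ ∷_) (take-prefix σs l≤k k≤)
  ... | no  l≰k = cong suc (begin
    mx (k ∷ p)                         ≡⟨ mx-maxLetter (k ∷ p) ⟩
    maxLetter (wordOf (k ∷ p))         ≡⟨ cong maxLetter word≡ ⟩
    blocks (bracket σs′)               ≡⟨ cong (λ τs → blocks (bracket τs)) (take-all l σs′ (≤-trans (≤-reflexive len′) (≰⇒> l≰k))) ⟨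
    blocks (bracket (take l σs′))      ∎)

partition-NumberOfComponents : ∀ p (vp : Valid p) → NumberOfComponents (partition p vp) (ht p)
partition-NumberOfComponents p vp = let (σs , c , len , _) = partition-components p vp in σs , c , len

-- Invariance under permutation of the patterns

containing-⊕-congʳ : ∀ α {β γ} → RGWFrom 0 β → RGWFrom 0 γ →
  (∀ φ n → containing β φ n ≡ containing γ φ n) →
  ∀ φ n → containing (α ⊕ β) φ n ≡ containing (α ⊕ γ) φ n
containing-⊕-congʳ α {β} {γ} gβ gγ h φ n = begin
  containing (α ⊕ β) φ n
    ≡⟨ containing-⊕ α β gβ φ n ⟩
  walksUntil (occurs α) (λ n u → containing β (λ n b → merge φ n (ht u) b) n) n []
    ≡⟨ walksUntil-cong (occurs α) (λ n u → h (λ n b → merge φ n (ht u) b) n) n [] ⟩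
  walksUntil (occurs α) (λ n u → containing γ (λ n b → merge φ n (ht u) b) n) n []
    ≡⟨ containing-⊕ α γ gγ φ n ⟨
  containing (α ⊕ γ) φ n ∎
  where open ≡-Reasoning

-- The weight stays quantified in the induction: behind a common first pattern, the remaining
-- patterns are counted with merged weights in place of `φ`.
bracket-↭ : ∀ {σs τs} → σs ↭ τs → ∀ φ n →
  containing (word (bracket σs)) φ n ≡ containing (word (bracket τs)) φ n
bracket-↭ Perm.refl φ n = refl
bracket-↭ {_ ∷ σs} {_ ∷ τs} (Perm.prep σ σs↭τs) =
  containing-⊕-congʳ (word σ) (word-RGW (bracket σs)) (word-RGW (bracket τs)) (bracket-↭ σs↭τs)
bracket-↭ {_ ∷ _ ∷ σs} {_ ∷ _ ∷ τs} (Perm.swap σ τ σs↭τs) φ n = trans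
  (containing-swap (word σ) (word τ) (word (bracket σs)) (word-RGW σ) (word-RGW τ) (word-RGW (bracket σs)) φ n)
  (containing-⊕-congʳ (word τ) (word-RGW (bracket (σ ∷ σs))) (word-RGW (bracket (σ ∷ τs)))
    (containing-⊕-congʳ (word σ) (word-RGW (bracket σs)) (word-RGW (bracket τs)) (bracket-↭ σs↭τs)) φ n)
bracket-↭ (Perm.trans p q) φ n = trans (bracket-↭ p φ n) (bracket-↭ q φ n)

-- Up to `↭`, lists form a commutative monoid under `++`, in which a tabulated list is the sum of
-- its singletons.
tabulate-permute : ∀ {A : Set} {k} (f : Fin k → A) (p : Permutation′ k) →
                   tabulate f ↭ tabulate (λ i → f (p ⟨$⟩ʳ i))
tabulate-permute {A} f p = ↭-trans (↭-reflexive (sym (sum-singletons f)))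
  (↭-trans (sum-permute (λ i → f i ∷ []) p) (↭-reflexive (sum-singletons (λ i → f (p ⟨$⟩ʳ i)))))
  where
  open CommutativeMonoidSum (++-commutativeMonoid {A = A}) using (sum-permute) renaming (sum to concat)
  sum-singletons : ∀ {k} (f : Fin k → A) → concat (λ i → f i ∷ []) ≡ tabulate f
  sum-singletons {zero}  f = refl
  sum-singletons {suc k} f = cong (f zero ∷_) (sum-singletons (f ∘ suc))

-- From counts to bijections

children : Path → List Path
children p = applyUpTo (_∷ p) (suc (ht p))

generate : ℕ → List Path
generate zero    = [] ∷ []
generate (suc n) = concatMap children (generate n)

generate⁺ : ∀ p → Valid p → p ∈ generate (length p)
generate⁺ []      _         = here refl
generate⁺ (k ∷ p) (k≤ , vp) = ∈-concatMap⁺ children (lose (generate⁺ p vp) (∈-applyUpTo⁺ (_∷ p) (s≤s k≤)))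

generate⁻ : ∀ n {p} → p ∈ generate n → Valid p × length p ≡ n
generate⁻ zero    (here refl) = tt , refl
generate⁻ (suc n) p∈ with find (∈-concatMap⁻ children {xs = generate n} p∈)
... | q , q∈ , p∈′ with ∈-applyUpTo⁻ (_∷ q) p∈′ | generate⁻ n q∈
...   | k , k< , refl | vq , refl = (s≤s⁻¹ k< , vq) , refl

generate-unique : ∀ n → Unique (generate n)
generate-unique zero    = [] ∷ []
generate-unique (suc n) = Unique.concat⁺
  (All.map⁺ (All.tabulate λ {p} _ → Unique.applyUpTo⁺₁ (_∷ p) (suc (ht p)) (λ i<j _ eq → <⇒≢ i<j (∷-injectiveˡ eq))))
  (AllPairs.map⁺ (AllPairs.map disjoint (generate-unique n)))
  where
  disjoint : ∀ {p q} → p ≢ q → ∀ {r} → ¬ (r ∈ children p × r ∈ children q)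
  disjoint {p} {q} p≢q (r∈p , r∈q) with ∈-applyUpTo⁻ (_∷ p) r∈p | ∈-applyUpTo⁻ (_∷ q) r∈q
  ... | _ , _ , refl | _ , _ , eq = p≢q (∷-injectiveʳ eq)

exactly : (Path → ℕ) → Weight Path
exactly g zero    p = g p
exactly g (suc n) p = 0

walks-delay : ∀ (φ : Weight Path) n p →
  walks (λ n q → delay (λ n → φ n q) n) n p ≡ delay (λ n → walks φ n p) n
walks-delay φ zero          p = refl
walks-delay φ (suc zero)    p = trans (cong (φ 0 p +_) (Σ<-0 (suc (ht p)))) (+-identityʳ _)
walks-delay φ (suc (suc n)) p = cong (φ (suc n) p +_) (Σ<-cong (suc (ht p)) (λ k → walks-delay φ (suc n) (k ∷ p)))

sum-concatMap : ∀ {A B : Set} (g : B → ℕ) (f : A → List B) xs →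
  sum (map g (concatMap f xs)) ≡ sum (map (λ x → sum (map g (f x))) xs)
sum-concatMap g f []       = refl
sum-concatMap g f (x ∷ xs) = trans (cong sum (map-++ g (f x) _))
  (trans (sum-++ (map g (f x)) _) (cong (sum (map g (f x)) +_) (sum-concatMap g f xs)))

sum-applyUpTo : ∀ {A : Set} (g : A → ℕ) (f : ℕ → A) n → sum (map g (applyUpTo f n)) ≡ Σ< n (λ i → g (f i))
sum-applyUpTo g f zero    = refl
sum-applyUpTo g f (suc n) = cong (g (f 0) +_) (sum-applyUpTo g (f ∘ suc) n)

-- `generate` adds steps at the end, so `walks-extend` first absorbs the last step into the weight
-- `g′`.
walks-exactly : ∀ n g → walks (exactly g) n [] ≡ sum (map g (generate n))
walks-exactly zero    g = sym (+-identityʳ _)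
walks-exactly (suc n) g = begin
  walks (exactly g) (suc n) []
    ≡⟨ walks-extend (exactly g) (suc n) [] ⟩
  walks (extend (exactly g)) (suc n) []
    ≡⟨ walks-cong (suc n) (λ n p _ → delay-cong (exactly-Σ< p) n) [] ⟩
  walks (λ n p → delay (λ n → exactly g′ n p) n) (suc n) []
    ≡⟨ walks-delay (exactly g′) (suc n) [] ⟩
  walks (exactly g′) n []
    ≡⟨ walks-exactly n g′ ⟩
  sum (map g′ (generate n))
    ≡⟨ cong sum (map-cong (λ p → sum-applyUpTo g (_∷ p) (suc (ht p))) (generate n)) ⟨
  sum (map (λ p → sum (map g (children p))) (generate n))
    ≡⟨ sum-concatMap g children (generate n) ⟨
  sum (map g (generate (suc n))) ∎
  where
  open ≡-Reasoning
  g′ : Path → ℕ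
  g′ p = Σ< (suc (ht p)) (λ k → g (k ∷ p))
  exactly-Σ< : ∀ p n → Σ< (suc (ht p)) (λ k → exactly g n (k ∷ p)) ≡ exactly g′ n p
  exactly-Σ< p zero    = refl
  exactly-Σ< p (suc n) = Σ<-0 (suc (ht p))

length-filter-filter : ∀ {A : Set} {P Q : A → Set} (P? : ∀ x → Dec (P x)) (Q? : ∀ x → Dec (Q x)) xs →
  length (filter P? (filter Q? xs)) ≡ sum (map (λ x → if does (P? x) then (if does (Q? x) then 1 else 0) else 0) xs)
length-filter-filter P? Q? []       = refl
length-filter-filter P? Q? (x ∷ xs) with does (Q? x)
... | true with does (P? x)
...   | true  = cong suc (length-filter-filter P? Q? xs)
...   | false = length-filter-filter P? Q? xs
length-filter-filter P? Q? (x ∷ xs) | false with does (P? x)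
...   | true  = length-filter-filter P? Q? xs
...   | false = length-filter-filter P? Q? xs

length-filter-¬ : ∀ {A : Set} {P : A → Set} (P? : ∀ x → Dec (P x)) xs →
  length (filter P? xs) + length (filter (λ x → ¬? (P? x)) xs) ≡ length xs
length-filter-¬ P? []       = refl
length-filter-¬ P? (x ∷ xs) with does (P? x)
... | true  = cong suc (length-filter-¬ P? xs)
... | false = trans (+-suc _ _) (cong suc (length-filter-¬ P? xs))

ofHeight : ℕ → ℕ → List Path
ofHeight n m = filter (λ p → ht p ≟ m) (generate n)

-- Only walks that use up the budget count, which fixes the size. `pred` undoes the shift by one in
-- `containing`.
weight : ℕ → ℕ → ℕ → ℕ
weight m zero    b = if does (pred b ≟ m) then 1 else 0
weight m (suc n) b = 0

length-containing : ∀ s n m → length (filter (λ p → wordOf p ⊒? s) (ofHeight n m)) ≡ containing s (weight m) n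
length-containing s n m = begin
  length (filter (λ p → wordOf p ⊒? s) (ofHeight n m))
    ≡⟨ length-filter-filter (λ p → wordOf p ⊒? s) (λ p → ht p ≟ m) (generate n) ⟩
  sum (map (λ p → if occurs s p then weight m 0 (suc (ht p)) else 0) (generate n))
    ≡⟨ walks-exactly n _ ⟨
  walks (exactly (λ p → if occurs s p then weight m 0 (suc (ht p)) else 0)) n []
    ≡⟨ walks-cong n (λ { zero p _ → refl ; (suc n) p _ → sym (by-cases (occurs s p)) }) [] ⟩
  containing s (weight m) n ∎
  where
  open ≡-Reasoning
  by-cases : ∀ b → (if b then 0 else 0) ≡ 0
  by-cases true  = refl
  by-cases false = refl

-- Opaque, so that s, n and m can be inferred from a membership.
opaque
  avoiding : List ℕ → ℕ → ℕ → List Path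
  avoiding s n m = filter (λ p → ¬? (wordOf p ⊒? s)) (ofHeight n m)

  avoiding⁺ : ∀ {s p} → Valid p → ¬ (wordOf p ⊒ s) → p ∈ avoiding s (length p) (ht p)
  avoiding⁺ {s} {p} vp av = ∈-filter⁺ (λ p → ¬? (wordOf p ⊒? s)) (∈-filter⁺ (λ q → ht q ≟ ht p) (generate⁺ p vp) refl) av

  avoiding⁻ : ∀ {s n m p} → p ∈ avoiding s n m → Valid p × ¬ (wordOf p ⊒ s) × length p ≡ n × ht p ≡ m
  avoiding⁻ {s} {n} {m} p∈ =
    let (p∈′ , av)  = ∈-filter⁻ (λ p → ¬? (wordOf p ⊒? s)) {xs = ofHeight n m} p∈
        (p∈″ , ht≡) = ∈-filter⁻ (λ p → ht p ≟ m) {xs = generate n} p∈′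
        (vp , len)  = generate⁻ n p∈″
    in vp , av , len , ht≡

  avoiding-unique : ∀ s n m → Unique (avoiding s n m)
  avoiding-unique s n m = Unique.filter⁺ (λ p → ¬? (wordOf p ⊒? s)) (Unique.filter⁺ (λ p → ht p ≟ m) (generate-unique n))

  avoiding-length : ∀ s t → (∀ φ n → containing s φ n ≡ containing t φ n) →
    ∀ n m → length (avoiding s n m) ≡ length (avoiding t n m)
  avoiding-length s t h n m = +-cancelˡ-≡ (length (filter (λ p → wordOf p ⊒? s) (ofHeight n m))) _ _ (begin
    length (filter (λ p → wordOf p ⊒? s) (ofHeight n m)) + length (avoiding s n m)
      ≡⟨ length-filter-¬ (λ p → wordOf p ⊒? s) (ofHeight n m) ⟩
    length (ofHeight n m)
      ≡⟨ length-filter-¬ (λ p → wordOf p ⊒? t) (ofHeight n m) ⟨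
    length (filter (λ p → wordOf p ⊒? t) (ofHeight n m)) + length (avoiding t n m)
      ≡⟨ cong (_+ length (avoiding t n m)) (trans (length-containing t n m) (trans (sym (h (weight m) n)) (sym (length-containing s n m)))) ⟩
    length (filter (λ p → wordOf p ⊒? s) (ofHeight n m)) + length (avoiding t n m) ∎)
    where open ≡-Reasoning

-- Pairing lists of equal length by position

module _ {A : Set} where

  mate : ∀ (xs ys : List A) → length xs ≡ length ys → ∀ {x} → x ∈ xs → A
  mate (_ ∷ xs) (y ∷ ys) eq (here _)   = y
  mate (_ ∷ xs) (y ∷ ys) eq (there x∈) = mate xs ys (suc-injective eq) x∈

  mate-∈ : ∀ xs ys (eq : length xs ≡ length ys) {x} (x∈ : x ∈ xs) → mate xs ys eq x∈ ∈ ys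
  mate-∈ (_ ∷ xs) (y ∷ ys) eq (here _)   = here refl
  mate-∈ (_ ∷ xs) (y ∷ ys) eq (there x∈) = there (mate-∈ xs ys (suc-injective eq) x∈)

  mate-injective : ∀ xs ys (eq : length xs ≡ length ys) → Unique ys →
    ∀ {x x′} (x∈ : x ∈ xs) (x′∈ : x′ ∈ xs) → mate xs ys eq x∈ ≡ mate xs ys eq x′∈ → x ≡ x′
  mate-injective (_ ∷ xs) (y ∷ ys) eq _        (here refl) (here refl) _ = refl
  mate-injective (_ ∷ xs) (y ∷ ys) eq (y∉ ∷ _) (here refl) (there x′∈) e =
    contradiction e (All.lookup y∉ (mate-∈ xs ys (suc-injective eq) x′∈))
  mate-injective (_ ∷ xs) (y ∷ ys) eq (y∉ ∷ _) (there x∈)  (here refl) e =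
    contradiction (sym e) (All.lookup y∉ (mate-∈ xs ys (suc-injective eq) x∈))
  mate-injective (_ ∷ xs) (y ∷ ys) eq (_ ∷ uys) (there x∈) (there x′∈) e =
    mate-injective xs ys (suc-injective eq) uys x∈ x′∈ e

  -- Without repetitions in `xs`, every membership of `x` has the same position. All memberships are
  -- covered because they are later rebuilt from words.
  mate-surjective : ∀ xs ys (eq : length xs ≡ length ys) → Unique xs → ∀ {y} → y ∈ ys →
    ∃[ x ] (x ∈ xs × (∀ (x∈ : x ∈ xs) → mate xs ys eq x∈ ≡ y))
  mate-surjective (x ∷ xs) (y ∷ ys) eq (x∉ ∷ _) (here refl) = x , here refl ,
    λ { (here _) → refl ; (there x∈) → contradiction refl (All.lookup x∉ x∈) }
  mate-surjective (x ∷ xs) (y ∷ ys) eq (x∉ ∷ uxs) (there y∈) with mate-surjective xs ys (suc-injective eq) uxs y∈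
  ... | z , z∈ , h = z , there z∈ ,
    λ { (here refl) → contradiction refl (All.lookup x∉ z∈) ; (there z∈′) → h z∈′ }

-- The bijection between avoiders

noncrossing-path : ∀ π → NonCrossing π → ∃[ p ] (Valid p × wordOf p ≡ word π)
noncrossing-path π nc = noncrossing⇒path (word-RGW π) (λ c → nc (crossing⇒1212 c))

avoider-path : ∀ σ (π : Avoiders σ) →
  ∃[ p ] (wordOf p ≡ word (value π) × p ∈ avoiding (word σ) (length p) (ht p))
avoider-path σ (π , irr h) =
  -- The irrelevant proof serves only to reach a contradiction, which `⊥-elim-irr` permits.
  let (p , vp , eq) = noncrossing-path π (λ c → ⊥-elim-irr (proj₁ h c))
  in p , eq , avoiding⁺ vp (λ c → ⊥-elim-irr (proj₂ h (subst (_⊒ word σ) eq c)))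

path-avoider : ∀ σ {n m p} → p ∈ avoiding (word σ) n m → Avoiders σ
path-avoider σ {p = p} p∈ =
  let (vp , av , _) = avoiding⁻ p∈
  in partition p vp , irr ((λ c → wordOf-noncrossing p vp (1212⇒crossing c)) , av)

avoiders-≡ : ∀ σ (π ρ : Avoiders σ) → word (value π) ≡ word (value ρ) → π ≡ ρ
avoiders-≡ σ π ρ eq = value-injective (value-injective eq)

path-unique : ∀ {s t n m n′ m′ p q} → p ∈ avoiding s n m → q ∈ avoiding t n′ m′ → wordOf p ≡ wordOf q → p ≡ q
path-unique p∈ q∈ = wordOf-injective _ _ (proj₁ (avoiding⁻ p∈)) (proj₁ (avoiding⁻ q∈))

components⇔ht : ∀ π {p} (vp : Valid p) → wordOf p ≡ word π → ∀ m → NumberOfComponents π m ⇔ (ht p ≡ m)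
components⇔ht π {p} vp eq m = mk⇔
  (components-unique {π} (subst (λ ρ → NumberOfComponents ρ (ht p)) part≡ (partition-NumberOfComponents p vp)))
  (λ { refl → subst (λ ρ → NumberOfComponents ρ (ht p)) part≡ (partition-NumberOfComponents p vp) })
  where
  part≡ : partition p vp ≡ π
  part≡ = value-injective eq

module _ (σ τ : Partition) (h : ∀ φ n → containing (word σ) φ n ≡ containing (word τ) φ n) where

  private
    s t : List ℕ
    s = word σ
    t = word τ

    match : ∀ {n m p} → p ∈ avoiding s n m → Path
    match {n} {m} = mate (avoiding s n m) (avoiding t n m) (avoiding-length s t h n m)

    match-∈ : ∀ {n m p} (p∈ : p ∈ avoiding s n m) → match p∈ ∈ avoiding t n m
    match-∈ {n} {m} = mate-∈ (avoiding s n m) (avoiding t n m) (avoiding-length s t h n m)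

    match-injective : ∀ {n m n′ m′ p p′} (p∈ : p ∈ avoiding s n m) (p′∈ : p′ ∈ avoiding s n′ m′) →
                      match p∈ ≡ match p′∈ → p ≡ p′
    match-injective {n} {m} {n′} {m′} p∈ p′∈ eq
      with avoiding⁻ {t} {n} {m} (match-∈ p∈) | avoiding⁻ {t} {n′} {m′} (match-∈ p′∈)
    ... | _ , _ , len , ht≡ | _ , _ , len′ , ht≡′
      -- Length and height of the common image show that both memberships refer to the same list.
      with trans (sym len) (trans (cong length eq) len′) | trans (sym ht≡) (trans (cong ht eq) ht≡′)
    ...   | refl | refl = mate-injective (avoiding s n m) (avoiding t n m) (avoiding-length s t h n m)
                            (avoiding-unique t n m) p∈ p′∈ eq

    match-surjective : ∀ {n m q} → q ∈ avoiding t n m →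
      ∃[ p ] (p ∈ avoiding s n m × (∀ (p∈ : p ∈ avoiding s (length p) (ht p)) → match p∈ ≡ q))
    match-surjective {n} {m} q∈
      with mate-surjective (avoiding s n m) (avoiding t n m) (avoiding-length s t h n m) (avoiding-unique s n m) q∈
    ... | p , p∈ , all with avoiding⁻ p∈
    ...   | _ , _ , refl , refl = p , p∈ , all

    image : Avoiders σ → Avoiders τ
    image π = let (_ , _ , p∈) = avoider-path σ π in path-avoider τ (match-∈ p∈)

    image-injective : ∀ {π ρ} → image π ≡ image ρ → π ≡ ρ
    image-injective {π} {ρ} eq =
      let (p , p≡ , p∈) = avoider-path σ π ; (q , q≡ , q∈) = avoider-path σ ρ in
      avoiders-≡ σ π ρ (trans (sym p≡) (trans
        (cong wordOf (match-injective p∈ q∈ (path-unique (match-∈ p∈) (match-∈ q∈) (cong (word ∘ value) eq)))) q≡))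

    image-surjective : ∀ ρ → ∃[ π ] (∀ {π′} → π′ ≡ π → image π′ ≡ ρ)
    image-surjective ρ =
      let (q , q≡ , q∈) = avoider-path τ ρ ; (p , p∈ , match≡) = match-surjective q∈ in
      path-avoider σ p∈ , λ { refl →
        -- `image` reads a path and a membership back from the word. The path is `p` by uniqueness,
        -- and `match≡` applies to any membership.
        let (_ , p′≡ , p′∈) = avoider-path σ (path-avoider σ p∈) in
        avoiders-≡ τ (image (path-avoider σ p∈)) ρ
          (trans (cong wordOf (transfer match≡ (path-unique p′∈ p∈ p′≡) p′∈)) q≡) }
      where
      transfer : ∀ {p p′ q} → (∀ (p∈ : p ∈ avoiding s (length p) (ht p)) → match p∈ ≡ q) → p′ ≡ p →
                 (p′∈ : p′ ∈ avoiding s (length p′) (ht p′)) → match p′∈ ≡ q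
      transfer match≡ refl = match≡

  ccEquivalent : NonCrossing σ → NonCrossing τ → CCEquivalent σ τ
  ccEquivalent ncσ ncτ = record
    { nonCrossingˡ = ncσ
    ; nonCrossingʳ = ncτ
    ; bijection    = mk⤖ ((λ {π} {ρ} → image-injective {π} {ρ}) , image-surjective)
    ; preservesSize = λ π →
        let (p , p≡ , p∈) = avoider-path σ π ; (_ , _ , len , _) = avoiding⁻ (match-∈ p∈) in
        trans (length-wordOf (match p∈)) (trans len (trans (sym (length-wordOf p)) (cong length p≡)))
    ; preservesComponents = λ π m →
        let (p , p≡ , p∈) = avoider-path σ π
            (vp , _) = avoiding⁻ p∈
            (vq , _ , _ , ht≡) = avoiding⁻ (match-∈ p∈)
            eπ = components⇔ht (value π) vp p≡ m
            eρ = components⇔ht (value (image π)) vq refl m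
        in mk⇔ (λ c → from eρ (trans ht≡ (to eπ c)))
               (λ c → from eπ (trans (sym ht≡) (to eρ c)))
    }

theorem3p4 : (k : ℕ) (σ : Fin k → Partition) (p : Permutation′ k) →
    (∀ i → NonCrossing (σ i)) →
    CCEquivalent (bracket (tabulate σ)) (bracket (tabulate (λ i → σ (p ⟨$⟩ʳ i))))
theorem3p4 k σ p nc = ccEquivalent (bracket (tabulate σ)) (bracket (tabulate (λ i → σ (p ⟨$⟩ʳ i))))
  (bracket-↭ (tabulate-permute σ p))
  (bracket-noncrossing (All.tabulate⁺ nc))
  (bracket-noncrossing (All.tabulate⁺ (λ i → nc (p ⟨$⟩ʳ i))))
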